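{- Let $\mathbb K$ be a field, let $(\kappa_n)_{n\ge1}$ be a sequence of elements of $\mathbb K$, regarded as a sequence of free cumulants, and let $(c_n)_{n\geq 1}$ be the corresponding sequence of classical cumulants. Then for every $n\ge 1$, \[-c_n=\sum_{\mathcal T\in\mathsf{Qcan}_{n-1}}(-\kappa_{\bullet+1})_{\mathbf q^{\mathcal T}},\] where $\mathsf{Qcan}_{n-1}$ is the set of quasicanonical trees on $[n-1]$, and $(-\kappa_{\bullet+1})_{\mathbf q}=\prod_{i=0}^k(-\kappa_{q_i+1})$ for $\mathbf q=(q_0,\ldots,q_k)$.
   Context: Cumulants: let $\Pi(n)$ be the set of set partitions of $[n]$, and $\mathrm{NC}(n)$ the set of noncrossing partitions of $[n]$ (no two distinct blocks $B,B'$ have $i,j\in B$, $i',j'\in B'$ with $i<i'<j<j'$ or $i>i'>j>j'$). Given the free cumulants $(\kappa_n)_{n\ge1}$, the moments are $m_n=\sum_{\eta\in\mathrm{NC}(n)}\prod_{B\in\eta}\kappa_{|B|}$, and the corresponding classical cumulants $(c_n)_{n\ge1}$ are the unique sequence in $\mathbb K$ with $m_n=\sum_{\rho\in\Pi(n)}\prod_{B\in\rho}c_{|B|}$ for all $n\ge1$. Trees: a binary plane tree is a (possibly empty) rooted tree in which each vertex has at most two children and each child is designated as a left or right child (at most one of each). A decreasing binary plane tree on a finite set $X$ of positive integers is a binary plane tree whose vertices are bijectively labeled by $X$ so that each nonroot vertex has a smaller label than its parent. For a nonempty tree $\mathcal T$ with root label $m$ and (possibly empty) left and right subtrees $\mathcal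 T_L,\mathcal T_R$ of the root, the in-order and postorder traversals are $\mathcal I(\mathcal T)=\mathcal I(\mathcal T_L)\,m\,\mathcal I(\mathcal T_R)$ and $\mathcal P(\mathcal T)=\mathcal P(\mathcal T_L)\,\mathcal P(\mathcal T_R)\,m$; both are the empty word for the empty tree. A decreasing binary plane tree is quasicanonical if every vertex $v$ that has a left child also has a nonempty right subtree $\mathcal T_v^R$ such that the first entry of $\mathcal P(\mathcal T_v^R)$ is smaller than the label of the left child of $v$. For a quasicanonical tree $\mathcal T$ with $N$ vertices, let $r_1<\cdots<r_p$ be the peaks of $\sigma=\mathcal I(\mathcal T)$, i.e. the indices $i\in\{2,\ldots,N-1\}$ with $\sigma_{i-1}<\sigma_i>\sigma_{i+1}$. Then $\mathbf q^{\mathcal T}=(r_1-1,\,r_2-r_1-1,\ldots,r_p-r_{p-1}-1,\,N-r_p)$, with $\mathbf q^{\mathcal T}=(N)$ if $p=0$ (including $N=0$ for the empty tree). -}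

module Defs where

open import Algebra.Apartness.Bundles using (HeytingField)
open import Data.Bool.Base using (if_then_else_)
open import Data.Fin.Base using (Fin) renaming (_<_ to _<ᶠ_)
open import Data.Fin.Properties using (any?; all?) renaming (_<?_ to _<ᶠ?_)
open import Data.Fin.Subset using (Subset; inside; outside; _∈_; _∩_; ∣_∣; Nonempty; Empty)
open import Data.Fin.Subset.Properties using (_∈?_; nonempty?)
open import Data.List.Base
  using (List; []; _∷_; [_]; _++_; map; foldr; filter; head;
         applyUpTo; cartesianProduct; cartesianProductWith)
import Data.List.Membership.DecPropositional as DecMembership
import Data.List.Relation.Unary.All as All
open import Data.List.Relation.Unary.All using (All)
import Data.List.Relation.Unary.AllPairs as AllPairs
open import Data.List.Relation.Unary.AllPairs using (AllPairs)
import Data.List.Relation.Unary.Any as Any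
open import Data.List.Relation.Unary.Any using (Any)
open import Data.List.Relation.Unary.Unique.DecPropositional using (unique?)
open import Data.List.Relation.Unary.Unique.Propositional using (Unique)
open import Data.Maybe.Base using (Maybe; just; nothing)
import Data.Maybe.Relation.Unary.All as MaybeAll
import Data.Maybe.Relation.Unary.Any as MaybeAny
open import Data.Nat.Base using (ℕ; zero; suc; _∸_; _<_) renaming (_+_ to _+ℕ_)
open import Data.Nat.Properties using (_≟_; _<?_)
open import Data.Product.Base using (∃-syntax; _×_; _,_)
open import Data.Sum.Base using (_⊎_)
open import Data.Tree.Binary using (Tree; leaf; node; #nodes; module Infix; module Suffix)
open import Data.Unit.Base using (⊤; tt)
open import Data.Vec.Base using () renaming ([] to []ᵛ; _∷_ to _∷ᵛ_)
open import Relation.Nullary using (¬_; Dec; yes; does; ¬?; _×-dec_; _⊎-dec_)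

open DecMembership _≟_ using () renaming (_∈_ to _∈ˡ_; _∈?_ to _∈ˡ?_)

-- The set [n] is modelled by Fin n with its order, and a set of blocks by a
-- list of subsets that is a sublist of the fixed duplicate-free list
-- `subsets n`, so that each set of blocks is represented exactly once.

subsets : ∀ n → List (Subset n)
subsets zero    = [ []ᵛ ]
subsets (suc n) = map (inside ∷ᵛ_) (subsets n) ++ map (outside ∷ᵛ_) (subsets n)

sublists : ∀ {a} {A : Set a} → List A → List (List A)
sublists []       = [ [] ]
sublists (x ∷ xs) = map (x ∷_) (sublists xs) ++ sublists xs

Disjoint : ∀ {n} → Subset n → Subset n → Set
Disjoint B C = Empty (B ∩ C)

IsPartition : ∀ {n} → List (Subset n) → Set
IsPartition η = All Nonempty η × AllPairs Disjoint η × (∀ i → Any (i ∈_) η)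

Crossing : ∀ {n} → Subset n → Subset n → Set
Crossing B B′ =
  ∃[ i ] ∃[ j ] ∃[ i′ ] ∃[ j′ ]
    ((i ∈ B × j ∈ B) × (i′ ∈ B′ × j′ ∈ B′)) ×
    ((i <ᶠ i′ × i′ <ᶠ j × j <ᶠ j′) ⊎ (i′ <ᶠ i × j <ᶠ i′ × j′ <ᶠ j))

-- AllPairs visits each pair of distinct blocks once; Crossing is symmetric.
Noncrossing : ∀ {n} → List (Subset n) → Set
Noncrossing = AllPairs (λ B B′ → ¬ Crossing B B′)

isPartition? : ∀ {n} (η : List (Subset n)) → Dec (IsPartition η)
isPartition? η =
  All.all? nonempty? η
    ×-dec AllPairs.allPairs? (λ B C → ¬? (nonempty? (B ∩ C))) η
    ×-dec all? (λ i → Any.any? (i ∈?_) η)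

crossing? : ∀ {n} (B B′ : Subset n) → Dec (Crossing B B′)
crossing? B B′ =
  any? λ i → any? λ j → any? λ i′ → any? λ j′ →
    ((i ∈? B ×-dec j ∈? B) ×-dec (i′ ∈? B′ ×-dec j′ ∈? B′)) ×-dec
    ((i <ᶠ? i′ ×-dec i′ <ᶠ? j ×-dec j <ᶠ? j′) ⊎-dec
     (i′ <ᶠ? i ×-dec j <ᶠ? i′ ×-dec j′ <ᶠ? j))

noncrossing? : ∀ {n} (η : List (Subset n)) → Dec (Noncrossing η)
noncrossing? = AllPairs.allPairs? (λ B B′ → ¬? (crossing? B B′))

Π : ∀ n → List (List (Subset n))
Π n = filter isPartition? (sublists (subsets n))

NC : ∀ n → List (List (Subset n))
NC n = filter noncrossing? (Π n)

-- Leaves of the library's trees are the empty subtrees; vertices are its nodes.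
BinaryPlaneTree : Set
BinaryPlaneTree = Tree ℕ ⊤

inorder postorder : BinaryPlaneTree → List ℕ
inorder   = Infix.toList
postorder = Suffix.toList

root : BinaryPlaneTree → Maybe ℕ
root (leaf _)     = nothing
root (node _ m _) = just m

LabelledBy : List ℕ → BinaryPlaneTree → Set
LabelledBy X t =
  Unique (inorder t) × All (_∈ˡ X) (inorder t) × All (_∈ˡ inorder t) X

Decreasing : BinaryPlaneTree → Set
Decreasing (leaf _)     = ⊤
Decreasing (node l m r) =
  (MaybeAll.All (_< m) (root l) × MaybeAll.All (_< m) (root r)) ×
  (Decreasing l × Decreasing r)

-- `MaybeAny.Any` entails that the postorder word has a first entry, i.e. that
-- the right subtree is nonempty.
Quasicanonical : BinaryPlaneTree → Set
Quasicanonical (leaf _)     = ⊤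
Quasicanonical (node l _ r) =
  MaybeAll.All (λ b → MaybeAny.Any (_< b) (head (postorder r))) (root l) ×
  (Quasicanonical l × Quasicanonical r)

IsQcan : List ℕ → BinaryPlaneTree → Set
IsQcan X t = LabelledBy X t × Decreasing t × Quasicanonical t

labelledBy? : ∀ X t → Dec (LabelledBy X t)
labelledBy? X t =
  unique? _≟_ (inorder t)
    ×-dec All.all? (_∈ˡ? X) (inorder t)
    ×-dec All.all? (_∈ˡ? inorder t) X

decreasing? : ∀ t → Dec (Decreasing t)
decreasing? (leaf _)     = yes tt
decreasing? (node l m r) =
  (MaybeAll.dec (_<? m) (root l) ×-dec MaybeAll.dec (_<? m) (root r))
    ×-dec (decreasing? l ×-dec decreasing? r)

quasicanonical? : ∀ t → Dec (Quasicanonical t)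
quasicanonical? (leaf _)     = yes tt
quasicanonical? (node l _ r) =
  MaybeAll.dec (λ b → MaybeAny.dec (_<? b) (head (postorder r))) (root l)
    ×-dec (quasicanonical? l ×-dec quasicanonical? r)

isQcan? : ∀ X t → Dec (IsQcan X t)
isQcan? X t = labelledBy? X t ×-dec decreasing? t ×-dec quasicanonical? t

-- All trees of height at most h with vertex labels drawn from X, each once
-- when X has no duplicates.
treesUpTo : ℕ → List ℕ → List BinaryPlaneTree
treesUpTo zero    X = [ leaf tt ]
treesUpTo (suc h) X =
  leaf tt ∷ cartesianProductWith (λ m (l , r) → node l m r) X
              (cartesianProduct (treesUpTo h X) (treesUpTo h X))

⟦1⋯_⟧ : ℕ → List ℕ
⟦1⋯ n ⟧ = applyUpTo suc n

-- A tree with n vertices has height at most n, so no tree is missed.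
Qcan : ℕ → List BinaryPlaneTree
Qcan n = filter (isQcan? ⟦1⋯ n ⟧) (treesUpTo n ⟦1⋯ n ⟧)

-- `peaksFrom i` expects i to be the (1-based) index of the second letter.
peaksFrom : ℕ → List ℕ → List ℕ
peaksFrom i (a ∷ b ∷ c ∷ w) =
  if does (a <? b ×-dec c <? b)
  then i ∷ peaksFrom (suc i) (b ∷ c ∷ w)
  else peaksFrom (suc i) (b ∷ c ∷ w)
peaksFrom _ _ = []

peaks : List ℕ → List ℕ
peaks = peaksFrom 2

-- `gaps N r (r₁ ∷ … ∷ rₚ ∷ [])` is (r₁-r-1, r₂-r₁-1, …, rₚ-rₚ₋₁-1, N-rₚ), and
-- (N-r) when p = 0; below it starts from r = 0.  Truncation never occurs there,
-- as 0 < r₁ < ⋯ < rₚ < N.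
gaps : ℕ → ℕ → List ℕ → List ℕ
gaps N r []        = [ N ∸ r ]
gaps N r (r₁ ∷ rs) = (r₁ ∸ r ∸ 1) ∷ gaps N r₁ rs

𝐪 : BinaryPlaneTree → List ℕ
𝐪 t = gaps (#nodes t) 0 (peaks (inorder t))

-- A sequence (aₙ)ₙ≥₁ is given as a function on ℕ; its value at 0 is never used,
-- since blocks of a partition are nonempty.
module Cumulants {c ℓ₁ ℓ₂} (K : HeytingField c ℓ₁ ℓ₂) where
  open HeytingField K

  ∑ ∏ : ∀ {a} {A : Set a} → List A → (A → Carrier) → Carrier
  ∑ xs f = foldr _+_ 0# (map f xs)
  ∏ xs f = foldr _*_ 1# (map f xs)

  momentFromFree : (ℕ → Carrier) → ℕ → Carrier
  momentFromFree κ n = ∑ (NC n) λ η → ∏ η λ B → κ ∣ B ∣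

  momentFromClassical : (ℕ → Carrier) → ℕ → Carrier
  momentFromClassical c n = ∑ (Π n) λ ρ → ∏ ρ λ B → c ∣ B ∣

  CorrespondingClassical : (κ c : ℕ → Carrier) → Set ℓ₁
  CorrespondingClassical κ c =
    ∀ n → 0 < n → momentFromFree κ n ≈ momentFromClassical c n

  weight : (ℕ → Carrier) → List ℕ → Carrier
  weight κ q = ∏ q λ qᵢ → - κ (qᵢ +ℕ 1)

{-# OPTIONS --safe #-}

-- Put aⱼ = -κⱼ₊₁ and, for a sequence h, let Φ h Y be the sum over the quasicanonical trees T on the
-- label set Y of h(q₀) a(q₁) ⋯ a(qₚ), where (q₀, …, qₚ) = 𝐪 T; the right-hand side of the theorem is
-- Φ a [n-1].  Deleting the root of a tree leaves either one tree whose q₀ is one less, or two trees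
-- (L, R) such that the first postorder entry of R is below the largest label of L.  A pair violating
-- that inequality is obtained from exactly one tree cut at a vertex of its first inorder segment
-- (reattach L below the first postorder leaf of R), so these pairs contribute Φ (a ∗ h), where
-- (a ∗ h)(k) = ∑_{j ≤ k} aⱼ h(k - j).  With (S h)(k) = h(k + 1) - (a ∗ h)(k), exponential generating
-- functions in the number of labels satisfy (Φ h)′ = Φ (S h) + Φ h · Φ a.
--
-- On the other hand S is the adjoint of Voiculescu's canonical operator: reading a noncrossing
-- partition point by point gives mₙ = (Sⁿ δ₀)(0), hence mₙ₊₁ = -(Sⁿ a)(0).  If M is the exponential
-- generating function of the moments, both facts together show by induction that M · Φ h has the
-- coefficients (Sⁿ h)(0); for h = a this reads M · Φ a = -M′.  Since M′ = C′ M for the generating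
-- function C of the classical cumulants, Φ a = -C′.
module Submission where

open import Defs
open import Algebra.Apartness.Bundles using (HeytingField; HeytingCommutativeRing)
open import Algebra.Bundles using (CommutativeRing)
open import Data.Bool.Base using (Bool; true; false; _∧_; not)
open import Data.Empty using (⊥-elim)
open import Data.Fin.Base as Fin using (Fin) renaming (_<_ to _<ᶠ_)
import Data.Fin.Properties as Finₚ
open import Data.Fin.Subset
  using (Subset; inside; outside; ⊥; ∁; _∪_; _∩_; ∣_∣; Nonempty) renaming (_∈_ to _∈ₛ_)
open import Data.Fin.Subset.Properties
  using (nonempty?; drop-there; x∈p∩q⁺; x∈p∩q⁻; x∈p∪q⁺; x∈p∪q⁻; ∪-identityʳ; ∣⊥∣≡0; ∣∁p∣≡n∸∣p∣; ∣p∣≤n; ∉⊥)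
  renaming (_∈?_ to _∈ₛ?_)
open import Data.List.Base
  using (List; []; _∷_; [_]; _++_; map; filter; head; length; replicate; applyDownFrom;
         cartesianProduct; cartesianProductWith)
open import Data.List.Membership.Propositional using (_∈_; _∉_)
open import Data.List.Membership.Propositional.Properties
  using (∈-++⁻; ∈-++⁺ˡ; ∈-++⁺ʳ; ∈-map⁻; ∈-filter⁺; ∈-filter⁻;
         ∈-applyUpTo⁺; ∈-applyUpTo⁻; ∈-applyDownFrom⁺; ∈-applyDownFrom⁻)
open import Data.List.Properties
  using (++-assoc; length-++; map-∘; map-id; length-replicate; length-applyDownFrom)
open import Data.List.Relation.Ternary.Interleaving.Propositional
  using (Interleaving; []; consˡ; consʳ)
open import Data.List.Relation.Unary.All as All using (All; []; _∷_)
import Data.List.Relation.Unary.All.Properties as Allₚ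
open import Data.List.Relation.Unary.AllPairs as AllPairs using (AllPairs; []; _∷_)
import Data.List.Relation.Unary.AllPairs.Properties as AllPairsₚ
open import Data.List.Relation.Unary.Any as Any using (Any; here; there)
import Data.List.Relation.Unary.Any.Properties as Anyₚ
open import Data.List.Relation.Unary.Unique.Propositional using (Unique)
import Data.List.Relation.Unary.Unique.Propositional.Properties as Uniqueₚ
open import Data.Maybe.Base using (Maybe; just; nothing)
import Data.Maybe.Relation.Unary.All as MaybeAll
import Data.Maybe.Relation.Unary.Any as MaybeAny
open import Data.Nat.Base as ℕ
  using (ℕ; zero; suc; _∸_; _<_; _≤_; _>_; z≤n; s≤s) renaming (_+_ to _+ℕ_)
open import Data.Nat.Properties as ℕₚ
  using (_≟_; _<?_; <-trans; <-irrefl; <-asym; <⇒≢; >⇒≢; ≤-refl; ≤-trans; m≤n⇒m≤1+n;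
         ∸-+-assoc; [m+n]∸[m+o]≡n∸o)
  renaming (+-comm to +ℕ-comm; +-identityʳ to +ℕ-identityʳ; +-suc to +ℕ-suc)
open import Data.List.Membership.DecPropositional _≟_ using (_∈?_)
open import Data.Product.Base using (∃-syntax; _×_; _,_; proj₁; proj₂; map₁; map₂)
open import Data.Sum.Base as Sum using (_⊎_; inj₁; inj₂; [_,_]′)
open import Data.Tree.Binary using (leaf; node; #nodes; module Infix; module Suffix)
open import Data.Unit.Base using (tt)
open import Data.Vec.Base using (here; there) renaming ([] to []ᵛ; _∷_ to _∷ᵛ_)
open import Function.Base using (_∘_; id)
open import Function.Bundles using (_⇔_; mk⇔; module Equivalence)
open import Relation.Binary.Core using (Rel)
open import Relation.Binary.Definitions using (tri<; tri≈; tri>)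
open import Relation.Binary.PropositionalEquality
  using (_≡_; refl; sym; trans; cong; cong₂; subst; module ≡-Reasoning)
open import Relation.Nullary
  using (¬_; Dec; yes; no; does; ¬?; contradiction; _×-dec_; _⊎-dec_; _→-dec_)
open import Relation.Nullary.Decidable using (does-⇔; dec-true; dec-false)
open import Relation.Unary using (Pred; Decidable)

-- Finite sums

-- Exponential generating functions are never formed. The coefficient of a product is a sum over
-- `splits Y`, one factor for each half, so no factorial is divided by and the characteristic of the
-- field does not matter. The two subtrees of a root carry arbitrary sets of labels, which is why
-- tree sums are indexed by descending lists and not by numbers; that `Φ a Y` depends only on the
-- length of `Y` comes out at the very end. The obstacle is the inequality between the first
-- postorder entry of the right subtree and the label of the left child. It couples the two sides,
-- so the pairs of subtrees are not a product, and the recursion closes only because the excluded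
-- pairs are again counted by a tree sum of the same kind. This forces the freedom in `h`: deleting
-- a root and cutting a tree both change the first gap alone, and all later gaps keep the weight
-- `a`.

splits : ∀ {a} {A : Set a} → List A → List (List A × List A)
splits []       = [ [] , [] ]
splits (y ∷ ys) = map (map₁ (y ∷_)) (splits ys) ++ map (map₂ (y ∷_)) (splits ys)

splits⇒interleaving : ∀ {a} {A : Set a} (ys : List A) {p} → p ∈ splits ys →
                      Interleaving (proj₁ p) (proj₂ p) ys
splits⇒interleaving []       (here refl) = []
splits⇒interleaving (y ∷ ys) p∈ with ∈-++⁻ (map (map₁ (y ∷_)) (splits ys)) p∈
... | inj₁ q with _ , q∈ , refl ← ∈-map⁻ (map₁ (y ∷_)) q = consˡ (splits⇒interleaving ys q∈)
... | inj₂ q with _ , q∈ , refl ← ∈-map⁻ (map₂ (y ∷_)) q = consʳ (splits⇒interleaving ys q∈)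

module Summation {c ℓ₁ ℓ₂} (K : HeytingField c ℓ₁ ℓ₂) where
  open HeytingField K using (heytingCommutativeRing)
  open CommutativeRing (HeytingCommutativeRing.commutativeRing heytingCommutativeRing) public
    hiding (refl; sym; trans; zero)
  open CommutativeRing (HeytingCommutativeRing.commutativeRing heytingCommutativeRing) public
    using () renaming (refl to ≈-refl; sym to ≈-sym; trans to ≈-trans)
  open Cumulants K public
  open import Algebra.Properties.CommutativeSemigroup +-commutativeSemigroup public
    using () renaming (interchange to +-interchange)
  open import Algebra.Properties.CommutativeSemigroup *-commutativeSemigroup public
    using () renaming (x∙yz≈y∙xz to *-leftComm)
  open import Algebra.Properties.Ring ring public
    using (-‿distribˡ-*; -‿distribʳ-*; -0#≈0#; -‿+-comm; -‿involutive; +-cancelʳ)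
  open import Relation.Binary.Reasoning.Setoid setoid public

  when : Bool → Carrier → Carrier
  when true  x = x
  when false x = 0#

  when-cong : ∀ b {x y} → (b ≡ true → x ≈ y) → when b x ≈ when b y
  when-cong true  x≈y = x≈y refl
  when-cong false x≈y = ≈-refl

  when-0 : ∀ b → when b 0# ≈ 0#
  when-0 true  = ≈-refl
  when-0 false = ≈-refl

  when-*ˡ : ∀ b x y → x * when b y ≈ when b (x * y)
  when-*ˡ true  x y = ≈-refl
  when-*ˡ false x y = zeroʳ x

  when-*ʳ : ∀ b x y → when b x * y ≈ when b (x * y)
  when-*ʳ true  x y = ≈-refl
  when-*ʳ false x y = zeroˡ y

  when-∧ : ∀ b b′ x → when (b ∧ b′) x ≡ when b (when b′ x)
  when-∧ true  b′ x = refl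
  when-∧ false b′ x = refl

  when-comm : ∀ b b′ x → when b (when b′ x) ≈ when b′ (when b x)
  when-comm true  b′ x = ≈-refl
  when-comm false b′ x = ≈-sym (when-0 b′)

  when-not : ∀ b x → when b x + when (not b) x ≈ x
  when-not true  x = +-identityʳ x
  when-not false x = +-identityˡ x

  when-⇔ : ∀ {p q} {P : Set p} {Q : Set q} → P ⇔ Q → (P? : Dec P) (Q? : Dec Q) → ∀ {x} →
           when (does P?) x ≈ when (does Q?) x
  when-⇔ P⇔Q P? Q? {x} = reflexive (cong (λ b → when b x) (does-⇔ P⇔Q P? Q?))

  when-yes : ∀ {p} {P : Set p} (P? : Dec P) → P → ∀ {x} → when (does P?) x ≈ x
  when-yes P? p = reflexive (cong (λ b → when b _) (dec-true P? p))

  when-no : ∀ {p} {P : Set p} (P? : Dec P) → ¬ P → ∀ {x} → when (does P?) x ≈ 0#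
  when-no P? ¬p = reflexive (cong (λ b → when b _) (dec-false P? ¬p))

  module _ {a} {A : Set a} where

    ∑-cong-∈ : ∀ (xs : List A) {f g} → (∀ {x} → x ∈ xs → f x ≈ g x) → ∑ xs f ≈ ∑ xs g
    ∑-cong-∈ []       eq = ≈-refl
    ∑-cong-∈ (x ∷ xs) eq = +-cong (eq (here refl)) (∑-cong-∈ xs (eq ∘ there))

    ∑-cong : ∀ (xs : List A) {f g} → (∀ x → f x ≈ g x) → ∑ xs f ≈ ∑ xs g
    ∑-cong xs eq = ∑-cong-∈ xs (λ {x} _ → eq x)

    ∑-0 : ∀ (xs : List A) → ∑ xs (λ _ → 0#) ≈ 0#
    ∑-0 []       = ≈-refl
    ∑-0 (x ∷ xs) = ≈-trans (+-identityˡ _) (∑-0 xs)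

    ∑-zero : ∀ (xs : List A) {f} → (∀ {x} → x ∈ xs → f x ≈ 0#) → ∑ xs f ≈ 0#
    ∑-zero xs eq = ≈-trans (∑-cong-∈ xs eq) (∑-0 xs)

    ∑-+ : ∀ (xs : List A) f g → ∑ xs (λ x → f x + g x) ≈ ∑ xs f + ∑ xs g
    ∑-+ []       f g = ≈-sym (+-identityˡ 0#)
    ∑-+ (x ∷ xs) f g = ≈-trans (+-congˡ (∑-+ xs f g)) (+-interchange _ _ _ _)

    ∑-*ˡ : ∀ (xs : List A) y f → ∑ xs (λ x → y * f x) ≈ y * ∑ xs f
    ∑-*ˡ []       y f = ≈-sym (zeroʳ y)
    ∑-*ˡ (x ∷ xs) y f = ≈-trans (+-congˡ (∑-*ˡ xs y f)) (≈-sym (distribˡ y _ _))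

    ∑-*ʳ : ∀ (xs : List A) y f → ∑ xs (λ x → f x * y) ≈ ∑ xs f * y
    ∑-*ʳ xs y f =
      ≈-trans (∑-cong xs (λ x → *-comm (f x) y)) (≈-trans (∑-*ˡ xs y f) (*-comm y _))

    ∑-neg : ∀ (xs : List A) f → ∑ xs (λ x → - f x) ≈ - ∑ xs f
    ∑-neg []       f = ≈-sym -0#≈0#
    ∑-neg (x ∷ xs) f = ≈-trans (+-congˡ (∑-neg xs f)) (-‿+-comm _ _)

    ∑-when : ∀ (xs : List A) b f → ∑ xs (λ x → when b (f x)) ≈ when b (∑ xs f)
    ∑-when xs true  f = ≈-refl
    ∑-when xs false f = ∑-0 xs

    ∑-++ : ∀ (xs ys : List A) f → ∑ (xs ++ ys) f ≈ ∑ xs f + ∑ ys f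
    ∑-++ []       ys f = ≈-sym (+-identityˡ _)
    ∑-++ (x ∷ xs) ys f = ≈-trans (+-congˡ (∑-++ xs ys f)) (≈-sym (+-assoc _ _ _))

    ∑-map : ∀ {b} {B : Set b} (h : B → A) xs f → ∑ (map h xs) f ≈ ∑ xs (f ∘ h)
    ∑-map h []       f = ≈-refl
    ∑-map h (x ∷ xs) f = +-congˡ (∑-map h xs f)

    ∑-filter : ∀ {p} {P : Pred A p} (P? : Decidable P) xs f →
               ∑ (filter P? xs) f ≈ ∑ xs (λ x → when (does (P? x)) (f x))
    ∑-filter P? []       f = ≈-refl
    ∑-filter P? (x ∷ xs) f with does (P? x)
    ... | true  = +-congˡ (∑-filter P? xs f)
    ... | false = ≈-trans (∑-filter P? xs f) (≈-sym (+-identityˡ _))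

    ∑-cartesianProductWith :
      ∀ {b c} {B : Set b} {C : Set c} (h : B → C → A) xs ys (f : A → Carrier) →
      ∑ (cartesianProductWith h xs ys) f ≈ ∑ xs (λ x → ∑ ys (λ y → f (h x y)))
    ∑-cartesianProductWith h []       ys f = ≈-refl
    ∑-cartesianProductWith h (x ∷ xs) ys f =
      ≈-trans (∑-++ (map (h x) ys) _ f) (+-cong (∑-map (h x) ys f) (∑-cartesianProductWith h xs ys f))

    ∑-unique : ∀ (_≟_ : ∀ (x y : A) → Dec (x ≡ y)) {xs y} (f : A → Carrier) → Unique xs → y ∈ xs →
               ∑ xs (λ x → when (does (x ≟ y)) (f x)) ≈ f y
    ∑-unique _≟_ {x ∷ xs} {y} f (x∉ ∷ _) (here refl) =
      ≈-trans (+-cong (when-yes (y ≟ y) refl) (∑-zero xs λ {z} z∈ → when-no (z ≟ y) (All.lookup x∉ z∈ ∘ sym)))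
              (+-identityʳ _)
    ∑-unique _≟_ {x ∷ xs} {y} f (x∉ ∷ u) (there y∈) =
      ≈-trans (+-cong (when-no (x ≟ y) (All.lookup x∉ y∈)) (∑-unique _≟_ f u y∈)) (+-identityˡ _)

  ∑-swap : ∀ {a b} {A : Set a} {B : Set b} (xs : List A) (ys : List B) (f : A → B → Carrier) →
           ∑ xs (λ x → ∑ ys (f x)) ≈ ∑ ys (λ y → ∑ xs (λ x → f x y))
  ∑-swap []       ys f = ≈-sym (∑-0 ys)
  ∑-swap (x ∷ xs) ys f = ≈-trans (+-congˡ (∑-swap xs ys f)) (≈-sym (∑-+ ys _ _))

  module _ {a} {A : Set a} where

    ∑-splits-∷ : ∀ y (ys : List A) f →
      ∑ (splits (y ∷ ys)) f ≈
      ∑ (splits ys) (λ (as , bs) → f (y ∷ as , bs)) + ∑ (splits ys) (λ (as , bs) → f (as , y ∷ bs))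
    ∑-splits-∷ y ys f =
      ≈-trans (∑-++ (map (map₁ (y ∷_)) (splits ys)) _ f)
              (+-cong (∑-map (map₁ (y ∷_)) (splits ys) f) (∑-map (map₂ (y ∷_)) (splits ys) f))

    -- Both sides distribute the letters of `ys` over three lists: this is associativity of the
    -- product of exponential generating functions.
    ∑-splits-assoc : ∀ (ys : List A) (f : List A → List A → List A → Carrier) →
      ∑ (splits ys) (λ (as , bs) → ∑ (splits bs) λ (cs , ds) → f as cs ds) ≈
      ∑ (splits ys) (λ (us , ds) → ∑ (splits us) λ (as , cs) → f as cs ds)
    ∑-splits-assoc []       f = ≈-refl
    ∑-splits-assoc (y ∷ ys) f = begin
      ∑ (splits (y ∷ ys)) (λ (as , bs) → ∑ (splits bs) λ (cs , ds) → f as cs ds)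
        ≈⟨ ∑-splits-∷ y ys _ ⟩
      ∑ S (λ (as , bs) → ∑ (splits bs) λ (cs , ds) → f (y ∷ as) cs ds) +
      ∑ S (λ (as , bs) → ∑ (splits (y ∷ bs)) λ (cs , ds) → f as cs ds)
        ≈⟨ +-congˡ (≈-trans (∑-cong S λ (as , bs) → ∑-splits-∷ y bs _) (∑-+ S _ _)) ⟩
      ∑ S (λ (as , bs) → ∑ (splits bs) λ (cs , ds) → f (y ∷ as) cs ds) +
      (∑ S (λ (as , bs) → ∑ (splits bs) λ (cs , ds) → f as (y ∷ cs) ds) +
       ∑ S (λ (as , bs) → ∑ (splits bs) λ (cs , ds) → f as cs (y ∷ ds)))
        ≈⟨ +-cong (∑-splits-assoc ys _) (+-cong (∑-splits-assoc ys _) (∑-splits-assoc ys _)) ⟩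
      ∑ S (λ (us , ds) → ∑ (splits us) λ (as , cs) → f (y ∷ as) cs ds) +
      (∑ S (λ (us , ds) → ∑ (splits us) λ (as , cs) → f as (y ∷ cs) ds) +
       ∑ S (λ (us , ds) → ∑ (splits us) λ (as , cs) → f as cs (y ∷ ds)))
        ≈⟨ +-assoc _ _ _ ⟨
      ∑ S (λ (us , ds) → ∑ (splits us) λ (as , cs) → f (y ∷ as) cs ds) +
      ∑ S (λ (us , ds) → ∑ (splits us) λ (as , cs) → f as (y ∷ cs) ds) +
      ∑ S (λ (us , ds) → ∑ (splits us) λ (as , cs) → f as cs (y ∷ ds))
        ≈⟨ +-congʳ (≈-trans (∑-cong S λ (us , ds) → ∑-splits-∷ y us _) (∑-+ S _ _)) ⟨
      ∑ S (λ (us , ds) → ∑ (splits (y ∷ us)) λ (as , cs) → f as cs ds) +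
      ∑ S (λ (us , ds) → ∑ (splits us) λ (as , cs) → f as cs (y ∷ ds))
        ≈⟨ ∑-splits-∷ y ys _ ⟨
      ∑ (splits (y ∷ ys)) (λ (us , ds) → ∑ (splits us) λ (as , cs) → f as cs ds) ∎
      where S = splits ys

    ∑-splits-[]ˡ : ∀ (ys : List A) f → (∀ {a as bs} → Interleaving (a ∷ as) bs ys → f (a ∷ as , bs) ≈ 0#) →
                   ∑ (splits ys) f ≈ f ([] , ys)
    ∑-splits-[]ˡ []       f z = +-identityʳ _
    ∑-splits-[]ˡ (y ∷ ys) f z = ≈-trans (∑-splits-∷ y ys f)
      (≈-trans (+-cong (∑-zero (splits ys) (z ∘ consˡ ∘ splits⇒interleaving ys))
                       (∑-splits-[]ˡ ys _ (z ∘ consʳ)))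
               (+-identityˡ _))

    ∑-splits-[]ʳ : ∀ (ys : List A) f → (∀ {as b bs} → Interleaving as (b ∷ bs) ys → f (as , b ∷ bs) ≈ 0#) →
                   ∑ (splits ys) f ≈ f (ys , [])
    ∑-splits-[]ʳ []       f z = +-identityʳ _
    ∑-splits-[]ʳ (y ∷ ys) f z = ≈-trans (∑-splits-∷ y ys f)
      (≈-trans (+-cong (∑-splits-[]ʳ ys _ (z ∘ consˡ))
                       (∑-zero (splits ys) (z ∘ consʳ ∘ splits⇒interleaving ys)))
               (+-identityʳ _))

    -- Stands in for division by a power series with constant term 1. Letter by letter, the terms
    -- with that letter in the second half agree and cancel, until only the extreme split is left.
    ∑-splits-cancel : ∀ (ys : List A) {f g} → ∑ (splits ys) f ≈ ∑ (splits ys) g →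
      (∀ {as b bs} → Interleaving as (b ∷ bs) ys → f (as , b ∷ bs) ≈ g (as , b ∷ bs)) →
      f (ys , []) ≈ g (ys , [])
    ∑-splits-cancel []       eq r = +-cancelʳ _ _ _ eq
    ∑-splits-cancel (y ∷ ys) {f} {g} eq r = ∑-splits-cancel ys
      (+-cancelʳ _ _ _ (begin
        _ ≈⟨ ∑-splits-∷ y ys f ⟨
        _ ≈⟨ eq ⟩
        _ ≈⟨ ∑-splits-∷ y ys g ⟩
        _ ≈⟨ +-congˡ (∑-cong-∈ (splits ys) (r ∘ consʳ ∘ splits⇒interleaving ys)) ⟨
        _ ∎))
      (r ∘ consˡ)

    -- `P` dictates the side of every letter, so a single split survives. With `P` the membership in
    -- a left subtree, the split read off from a tree becomes a sum over all splits.
    ∑-splits-filter : ∀ {p} {P : Pred A p} (P? : Decidable P) (ys : List A) f →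
      (∀ {as bs} → Interleaving as bs ys → f (as , bs) ≈ 0# ⊎ (All P as × All (¬_ ∘ P) bs)) →
      ∑ (splits ys) f ≈ f (filter P? ys , filter (¬? ∘ P?) ys)
    ∑-splits-filter P? []       f z = +-identityʳ _
    ∑-splits-filter {P = P} P? (y ∷ ys) f z with P? y
    ... | yes py = ≈-trans (∑-splits-∷ y ys f)
      (≈-trans (+-cong (∑-splits-filter P? ys _ onˡ)
                       (∑-zero (splits ys) (offʳ ∘ splits⇒interleaving ys)))
               (+-identityʳ _))
      where
      onˡ : ∀ {as bs} → Interleaving as bs ys → f (y ∷ as , bs) ≈ 0# ⊎ (All P as × All (¬_ ∘ P) bs)
      onˡ i with z (consˡ i)
      ... | inj₁ e               = inj₁ e
      ... | inj₂ ((_ ∷ ps) , qs) = inj₂ (ps , qs)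
      offʳ : ∀ {as bs} → Interleaving as bs ys → f (as , y ∷ bs) ≈ 0#
      offʳ i with z (consʳ i)
      ... | inj₁ e              = e
      ... | inj₂ (_ , (¬p ∷ _)) = contradiction py ¬p
    ... | no ¬py = ≈-trans (∑-splits-∷ y ys f)
      (≈-trans (+-cong (∑-zero (splits ys) (offˡ ∘ splits⇒interleaving ys))
                       (∑-splits-filter P? ys _ onʳ))
               (+-identityˡ _))
      where
      onʳ : ∀ {as bs} → Interleaving as bs ys → f (as , y ∷ bs) ≈ 0# ⊎ (All P as × All (¬_ ∘ P) bs)
      onʳ i with z (consʳ i)
      ... | inj₁ e               = inj₁ e
      ... | inj₂ (ps , (_ ∷ qs)) = inj₂ (ps , qs)
      offˡ : ∀ {as bs} → Interleaving as bs ys → f (y ∷ as , bs) ≈ 0#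
      offˡ i with z (consˡ i)
      ... | inj₁ e             = e
      ... | inj₂ ((p ∷ _) , _) = contradiction p ¬py

-- Quasicanonical trees

AllPairs-++⁻ : ∀ {a ℓ} {A : Set a} {R : Rel A ℓ} xs {ys} → AllPairs R (xs ++ ys) →
               AllPairs R xs × AllPairs R ys × All (λ x → All (R x) ys) xs
AllPairs-++⁻ []       rs       = [] , rs , []
AllPairs-++⁻ (x ∷ xs) (r ∷ rs) with AllPairs-++⁻ xs rs
... | rxs , rys , rxys = Allₚ.++⁻ˡ xs r ∷ rxs , rys , Allₚ.++⁻ʳ xs r ∷ rxys

module _ {a} {A : Set a} where

  interleaving-∈ˡ : ∀ {as bs ys : List A} {x} → Interleaving as bs ys → x ∈ as → x ∈ ys
  interleaving-∈ˡ (consˡ i) (here refl) = here refl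
  interleaving-∈ˡ (consˡ i) (there x∈)  = there (interleaving-∈ˡ i x∈)
  interleaving-∈ˡ (consʳ i) x∈          = there (interleaving-∈ˡ i x∈)

  interleaving-∈ʳ : ∀ {as bs ys : List A} {x} → Interleaving as bs ys → x ∈ bs → x ∈ ys
  interleaving-∈ʳ (consʳ i) (here refl) = here refl
  interleaving-∈ʳ (consʳ i) (there x∈)  = there (interleaving-∈ʳ i x∈)
  interleaving-∈ʳ (consˡ i) x∈          = there (interleaving-∈ʳ i x∈)

  interleaving-All : ∀ {p} {P : Pred A p} {as bs ys : List A} → Interleaving as bs ys →
                     All P ys → All P as × All P bs
  interleaving-All i ps = All.tabulate (All.lookup ps ∘ interleaving-∈ˡ i) ,
                          All.tabulate (All.lookup ps ∘ interleaving-∈ʳ i)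

  interleaving-AllPairs : ∀ {r} {R : Rel A r} {as bs ys : List A} → Interleaving as bs ys →
                          AllPairs R ys → AllPairs R as × AllPairs R bs
  interleaving-AllPairs []        []       = [] , []
  interleaving-AllPairs (consˡ i) (r ∷ rs) with interleaving-AllPairs i rs
  ... | ras , rbs = proj₁ (interleaving-All i r) ∷ ras , rbs
  interleaving-AllPairs (consʳ i) (r ∷ rs) with interleaving-AllPairs i rs
  ... | ras , rbs = ras , proj₂ (interleaving-All i r) ∷ rbs

  interleaving-disjoint : ∀ {as bs ys : List A} {x} → Interleaving as bs ys → Unique ys →
                          x ∈ as → x ∉ bs
  interleaving-disjoint (consˡ i) (y≢ ∷ u) (here refl) x∈b = All.lookup y≢ (interleaving-∈ʳ i x∈b) refl
  interleaving-disjoint (consˡ i) (y≢ ∷ u) (there x∈a) x∈b = interleaving-disjoint i u x∈a x∈b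
  interleaving-disjoint (consʳ i) (y≢ ∷ u) x∈a (here refl) = All.lookup y≢ (interleaving-∈ˡ i x∈a) refl
  interleaving-disjoint (consʳ i) (y≢ ∷ u) x∈a (there x∈b) = interleaving-disjoint i u x∈a x∈b

pattern ∅ = leaf tt

infix-++ : ∀ (t : BinaryPlaneTree) xs → Infix.toDiffList t xs ≡ inorder t ++ xs
infix-++ ∅            xs = refl
infix-++ (node l m r) xs = begin
  Infix.toDiffList l (m ∷ Infix.toDiffList r xs) ≡⟨ infix-++ l _ ⟩
  inorder l ++ m ∷ Infix.toDiffList r xs         ≡⟨ cong (λ w → inorder l ++ m ∷ w) (infix-++ r xs) ⟩
  inorder l ++ (m ∷ inorder r) ++ xs             ≡⟨ ++-assoc (inorder l) _ xs ⟨
  (inorder l ++ m ∷ inorder r) ++ xs             ≡⟨ cong (_++ xs) (infix-++ l (m ∷ inorder r)) ⟨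
  inorder (node l m r) ++ xs                     ∎
  where open ≡-Reasoning

suffix-++ : ∀ (t : BinaryPlaneTree) xs → Suffix.toDiffList t xs ≡ postorder t ++ xs
suffix-++ ∅            xs = refl
suffix-++ (node l m r) xs = begin
  Suffix.toDiffList l (Suffix.toDiffList r (m ∷ xs)) ≡⟨ suffix-++ l _ ⟩
  postorder l ++ Suffix.toDiffList r (m ∷ xs)        ≡⟨ cong (postorder l ++_) (suffix-++ r _) ⟩
  postorder l ++ postorder r ++ m ∷ xs
      ≡⟨ cong (postorder l ++_) (++-assoc (postorder r) [ m ] xs) ⟨
  postorder l ++ (postorder r ++ [ m ]) ++ xs
      ≡⟨ cong (λ w → postorder l ++ w ++ xs) (suffix-++ r [ m ]) ⟨
  postorder l ++ Suffix.toDiffList r [ m ] ++ xs     ≡⟨ ++-assoc (postorder l) _ xs ⟨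
  (postorder l ++ Suffix.toDiffList r [ m ]) ++ xs   ≡⟨ cong (_++ xs) (suffix-++ l _) ⟨
  postorder (node l m r) ++ xs                       ∎
  where open ≡-Reasoning

inorder-node : ∀ l m r → inorder (node l m r) ≡ inorder l ++ m ∷ inorder r
inorder-node l m r = infix-++ l (m ∷ inorder r)

postorder-node : ∀ l m r → postorder (node l m r) ≡ postorder l ++ postorder r ++ [ m ]
postorder-node l m r = trans (suffix-++ l _) (cong (postorder l ++_) (suffix-++ r [ m ]))

firstPost : BinaryPlaneTree → Maybe ℕ
firstPost = head ∘ postorder

head-++ : ∀ {a} {A : Set a} {xs : List A} {x} ys → head xs ≡ just x → head (xs ++ ys) ≡ just x
head-++ {xs = _ ∷ _} ys eq = eq

firstPost-leafˡ : ∀ m {r f} → firstPost r ≡ just f → firstPost (node ∅ m r) ≡ just f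
firstPost-leafˡ m {r} eq = trans (cong head (postorder-node ∅ m r)) (head-++ [ m ] eq)

firstPost-left : ∀ {l} m r {f} → firstPost l ≡ just f → firstPost (node l m r) ≡ just f
firstPost-left {l} m r eq = trans (cong head (postorder-node l m r)) (head-++ _ eq)

firstPost-∈ : ∀ l m r → ∃[ f ] firstPost (node l m r) ≡ just f × f ∈ inorder (node l m r)
firstPost-∈ l@(node l₁ a r₁) m r with f , eq , f∈ ← firstPost-∈ l₁ a r₁ =
  f , firstPost-left {l} m r eq , subst (f ∈_) (sym (inorder-node l m r)) (∈-++⁺ˡ f∈)
firstPost-∈ ∅ m r@(node l₁ a r₁) with f , eq , f∈ ← firstPost-∈ l₁ a r₁ =
  f , firstPost-leafˡ m {r} eq , there f∈
firstPost-∈ ∅ m ∅ = m , refl , here refl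

-- This order puts the largest label at the head, where it is the root label of every decreasing
-- tree on the list, and both halves of a split inherit it.
Descending : List ℕ → Set
Descending = AllPairs _>_

Descending⇒Unique : ∀ {Y} → Descending Y → Unique Y
Descending⇒Unique = AllPairs.map >⇒≢

decreasing-bound : ∀ {m} t → Decreasing t → MaybeAll.All (_< m) (root t) → All (_< m) (inorder t)
decreasing-bound ∅ _ _ = []
decreasing-bound {m} (node l a r) ((l< , r<) , dl , dr) (MaybeAll.just a<m) =
  subst (All (_< m)) (sym (inorder-node l a r))
    (Allₚ.++⁺ (All.map (λ p → <-trans p a<m) (decreasing-bound l dl l<))
              (a<m ∷ All.map (λ p → <-trans p a<m) (decreasing-bound r dr r<)))

root-bound : ∀ {m} t → All (_< m) (inorder t) → MaybeAll.All (_< m) (root t)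
root-bound ∅            _ = MaybeAll.nothing
root-bound {m} (node l a r) p =
  MaybeAll.just (All.head (Allₚ.++⁻ʳ (inorder l) (subst (All (_< m)) (inorder-node l a r) p)))

RootCondition : BinaryPlaneTree → BinaryPlaneTree → Set
RootCondition l r = MaybeAll.All (λ b → MaybeAny.Any (_< b) (firstPost r)) (root l)

rootCondition? : ∀ l r → Dec (RootCondition l r)
rootCondition? l r = MaybeAll.dec (λ b → MaybeAny.dec (_<? b) (firstPost r)) (root l)

isQcan-[] : ∀ {l m r} → ¬ IsQcan [] (node l m r)
isQcan-[] {l} {m} {r} ((_ , ⊆[] , _) , _)
  with () ← All.lookup ⊆[] (subst (m ∈_) (sym (inorder-node l m r)) (∈-++⁺ʳ (inorder l) (here refl)))

isQcan-∷-leaf : ∀ {y Y} → ¬ IsQcan (y ∷ Y) ∅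
isQcan-∷-leaf ((_ , _ , () ∷ _) , _)

-- If `y` lay in a subtree it would be smaller than `m`; but `m` is itself a letter of `y ∷ Y`,
-- hence at most `y`.
isQcan-root : ∀ {y Y l m r} → Descending (y ∷ Y) → IsQcan (y ∷ Y) (node l m r) → m ≡ y
isQcan-root {y} {Y} {l} {m} {r} (y> ∷ _) ((_ , ⊆Y , y∈ ∷ _) , ((l< , r<) , dl , dr) , _)
  rewrite inorder-node l m r
  with ∈-++⁻ (inorder l) y∈
... | inj₂ (here refl) = refl
... | inj₁ y∈l = ⊥-elim (y≮m (All.lookup (decreasing-bound l dl l<) y∈l))
  where
  y≮m : ¬ y < m
  y≮m y<m with All.lookup ⊆Y (∈-++⁺ʳ (inorder l) (here refl))
  ... | here refl = <-irrefl refl y<m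
  ... | there m∈  = <-asym y<m (All.lookup y> m∈)
... | inj₂ (there y∈r) = ⊥-elim (y≮m (All.lookup (decreasing-bound r dr r<) y∈r))
  where
  y≮m : ¬ y < m
  y≮m y<m with All.lookup ⊆Y (∈-++⁺ʳ (inorder l) (here refl))
  ... | here refl = <-irrefl refl y<m
  ... | there m∈  = <-asym y<m (All.lookup y> m∈)

root≡head : ∀ {y Y t} → Descending (y ∷ Y) → IsQcan (y ∷ Y) t → root t ≡ just y
root≡head {t = ∅}          _ q = ⊥-elim (isQcan-∷-leaf q)
root≡head {t = node l m r} d q = cong just (isQcan-root {l = l} {r = r} d q)

-- A tree determines how its labels split: those met in `l` go left, all others right. Writing both
-- halves as filters avoids an existential quantifier over splits.
isQcan-node : ∀ {y Y l r} → Descending (y ∷ Y) →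
  IsQcan (y ∷ Y) (node l y r) ⇔
  (IsQcan (filter (_∈? inorder l) Y) l ×
   IsQcan (filter (¬? ∘ (_∈? inorder l)) Y) r × RootCondition l r)
isQcan-node {y} {Y} {l} {r} (y> ∷ _) = mk⇔ to from
  where
  to : IsQcan (y ∷ Y) (node l y r) →
       IsQcan (filter (_∈? inorder l) Y) l × IsQcan (filter (¬? ∘ (_∈? inorder l)) Y) r × RootCondition l r
  to ((u , ⊆Y , _ ∷ Y⊆) , (_ , dl , dr) , (rc , ql , qr))
    rewrite inorder-node l y r
    with ul , (y∉ ∷ ur) , lr ← AllPairs-++⁻ (inorder l) u =
    ((ul , All.tabulate l⊆ , Allₚ.all-filter (_∈? inorder l) Y) , dl , ql) ,
    ((ur , All.tabulate r⊆ , All.tabulate ⊆r) , dr , qr) , rc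
    where
    l⊆ : ∀ {x} → x ∈ inorder l → x ∈ filter (_∈? inorder l) Y
    l⊆ x∈ with All.lookup ⊆Y (∈-++⁺ˡ x∈)
    ... | here refl = ⊥-elim (All.head (All.lookup lr x∈) refl)
    ... | there x∈Y = ∈-filter⁺ (_∈? inorder l) x∈Y x∈
    r⊆ : ∀ {x} → x ∈ inorder r → x ∈ filter (¬? ∘ (_∈? inorder l)) Y
    r⊆ x∈ with All.lookup ⊆Y (∈-++⁺ʳ (inorder l) (there x∈))
    ... | here refl = ⊥-elim (All.lookup y∉ x∈ refl)
    ... | there x∈Y = ∈-filter⁺ (¬? ∘ (_∈? inorder l)) x∈Y
                        λ x∈l → All.lookup (All.tail (All.lookup lr x∈l)) x∈ refl
    ⊆r : ∀ {x} → x ∈ filter (¬? ∘ (_∈? inorder l)) Y → x ∈ inorder r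
    ⊆r x∈ with x∈Y , x∉l ← ∈-filter⁻ (¬? ∘ (_∈? inorder l)) {xs = Y} x∈
          with ∈-++⁻ (inorder l) (All.lookup Y⊆ x∈Y)
    ... | inj₁ x∈l         = ⊥-elim (x∉l x∈l)
    ... | inj₂ (here refl) = ⊥-elim (<-irrefl refl (All.lookup y> x∈Y))
    ... | inj₂ (there x∈r) = x∈r
  from : IsQcan (filter (_∈? inorder l) Y) l × IsQcan (filter (¬? ∘ (_∈? inorder l)) Y) r × RootCondition l r →
         IsQcan (y ∷ Y) (node l y r)
  from (((ul , l⊆ , _) , dl , ql) , ((ur , r⊆ , ⊆r) , dr , qr) , rc)
    rewrite inorder-node l y r =
    (AllPairsₚ.++⁺ ul (All.map (λ p q → <-irrefl (sym q) p) r<y ∷ ur)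
       (All.tabulate λ x∈l → (<⇒≢ (All.lookup l<y x∈l)) ∷ All.tabulate λ x∈r → λ where refl → r∉l x∈r x∈l) ,
     Allₚ.++⁺ (All.tabulate (there ∘ l⊆Y)) (here refl ∷ All.tabulate (there ∘ r⊆Y)) ,
     ∈-++⁺ʳ (inorder l) (here refl) ∷ All.tabulate Y⊆) ,
    ((root-bound l l<y , root-bound r r<y) , dl , dr) , (rc , ql , qr)
    where
    l⊆Y : ∀ {x} → x ∈ inorder l → x ∈ Y
    l⊆Y x∈ = proj₁ (∈-filter⁻ (_∈? inorder l) {xs = Y} (All.lookup l⊆ x∈))
    r⊆Y : ∀ {x} → x ∈ inorder r → x ∈ Y
    r⊆Y x∈ = proj₁ (∈-filter⁻ (¬? ∘ (_∈? inorder l)) {xs = Y} (All.lookup r⊆ x∈))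
    r∉l : ∀ {x} → x ∈ inorder r → x ∉ inorder l
    r∉l x∈ = proj₂ (∈-filter⁻ (¬? ∘ (_∈? inorder l)) {xs = Y} (All.lookup r⊆ x∈))
    l<y : All (_< y) (inorder l)
    l<y = All.tabulate (All.lookup y> ∘ l⊆Y)
    r<y : All (_< y) (inorder r)
    r<y = All.tabulate (All.lookup y> ∘ r⊆Y)
    Y⊆ : ∀ {x} → x ∈ Y → x ∈ inorder l ++ y ∷ inorder r
    Y⊆ {x} x∈ with x ∈? inorder l
    ... | yes x∈l = ∈-++⁺ˡ x∈l
    ... | no  x∉l = ∈-++⁺ʳ (inorder l) (there (All.lookup ⊆r (∈-filter⁺ (¬? ∘ (_∈? inorder l)) x∈ x∉l)))

-- Uniqueness of the split: the labels of `l` are exactly `A`, and `Y` has no repetition. This is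
-- the condition under which `∑-splits-filter` applies.
isQcan-separates : ∀ {A B Y l r} → Descending Y → Interleaving A B Y → IsQcan A l → IsQcan B r →
                   All (_∈ inorder l) A × All (_∉ inorder l) B
isQcan-separates d i ((_ , l⊆A , A⊆l) , _) _ =
  A⊆l , All.tabulate λ x∈B x∈l → interleaving-disjoint i (Descending⇒Unique d) (All.lookup l⊆A x∈l) x∈B

interleaving-length : ∀ {a} {A : Set a} {as bs ys : List A} → Interleaving as bs ys →
                      length as ≤ length ys × length bs ≤ length ys
interleaving-length []        = z≤n , z≤n
interleaving-length (consˡ i) with p , q ← interleaving-length i = s≤s p , m≤n⇒m≤1+n q
interleaving-length (consʳ i) with p , q ← interleaving-length i = m≤n⇒m≤1+n p , s≤s q

-- A missing first entry counts as +∞ and the head of an empty list as -∞.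
below : Maybe ℕ → List ℕ → Bool
below f []      = false
below f (a ∷ _) = does (MaybeAny.dec (_<? a) f)

below-nothing : ∀ A → below nothing A ≡ false
below-nothing []      = refl
below-nothing (a ∷ _) = refl

firstPost-just : ∀ {y Y t} → IsQcan (y ∷ Y) t → ∃[ f ] firstPost t ≡ just f × f ∈ y ∷ Y
firstPost-just {t = ∅}          q = ⊥-elim (isQcan-∷-leaf q)
firstPost-just {t = node l m r} q@((_ , t⊆ , _) , _) with f , eq , f∈ ← firstPost-∈ l m r =
  f , eq , All.lookup t⊆ f∈

-- The root `y` comes first in postorder only if `r` is empty too; then both sides are false, since
-- `y` exceeds all of `A`.
below-leafˡ : ∀ {y A r} → All (_< y) A → below (firstPost (node ∅ y r)) A ≡ below (firstPost r) A
below-leafˡ {A = []} _ = refl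
below-leafˡ {y} {a ∷ A} {∅} (a<y ∷ _) = dec-false (y <? a) (<-asym a<y)
below-leafˡ {y} {a ∷ A} {r@(node l₁ m₁ r₁)} _ with f , eq , _ ← firstPost-∈ l₁ m₁ r₁ =
  cong (λ f → below f (a ∷ A)) (trans (firstPost-leafˡ y {r} eq) (sym eq))

-- The first postorder entry of l is a letter of C; as it is not below A, c exceeds the head of A.
not-below⇒head : ∀ {A c C U l f} → Descending U → Interleaving A (c ∷ C) U → IsQcan (c ∷ C) l →
  not (below (firstPost l) A) ≡ true → below f (c ∷ C) ≡ below f U
not-below⇒head _ (consʳ i) _ _ = refl
not-below⇒head {a ∷ A} {l = l} (a> ∷ _) (consˡ i) q eq with f , eq′ , f∈ ← firstPost-just {t = l} q
  rewrite eq′ | dec-true (f <? a) (All.lookup (proj₂ (interleaving-All i a>)) f∈) with () ← eq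

-- Tree sums and their recursion at the root

module TreeSums {c ℓ₁ ℓ₂} (K : HeytingField c ℓ₁ ℓ₂) where
  open Summation K

  -- convolve b h k = ∑_{j ≤ k} b j * h (k - j)
  convolve : (ℕ → Carrier) → (ℕ → Carrier) → ℕ → Carrier
  convolve b h zero    = b 0 * h 0
  convolve b h (suc k) = b 0 * h (suc k) + convolve (b ∘ suc) h k

  module Trees (X : List ℕ) (X! : Unique X) where

    -- The pool `X` of labels stays fixed while `Y` shrinks, so that the subtrees of an enumerated
    -- tree are enumerated over the same pool, with a smaller bound on the height.
    trees≤ : ℕ → List ℕ → List BinaryPlaneTree
    trees≤ k Y = filter (isQcan? Y) (treesUpTo k X)

    trees : List ℕ → List BinaryPlaneTree
    trees Y = trees≤ (length Y) Y

    Valid : List ℕ → Set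
    Valid Y = Descending Y × All (_∈ X) Y

    valid-interleaving : ∀ {A B Y} → Interleaving A B Y → Valid Y → Valid A × Valid B
    valid-interleaving i (d , ⊆X) with dA , dB ← interleaving-AllPairs i d | A⊆ , B⊆ ← interleaving-All i ⊆X =
      (dA , A⊆) , (dB , B⊆)

    valid-tail : ∀ {y Y} → Valid (y ∷ Y) → Valid Y
    valid-tail (_ ∷ d , _ ∷ ⊆X) = d , ⊆X

    trees≤-IsQcan : ∀ {k Y t} → t ∈ trees≤ k Y → IsQcan Y t
    trees≤-IsQcan {k} {Y} t∈ = proj₂ (∈-filter⁻ (isQcan? Y) {xs = treesUpTo k X} t∈)

    ∑-trees-[] : ∀ k g → ∑ (trees≤ k []) g ≈ g ∅
    ∑-trees-[] k g = ≈-trans (∑-filter (isQcan? []) (treesUpTo k X) g) (go k)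
      where
      go : ∀ k → ∑ (treesUpTo k X) (λ t → when (does (isQcan? [] t)) (g t)) ≈ g ∅
      go zero    = +-identityʳ _
      go (suc k) = ≈-trans (+-congˡ (≈-trans
        (∑-cartesianProductWith _ X _ _)
        (∑-zero X λ {m} _ → ∑-zero (cartesianProduct (treesUpTo k X) (treesUpTo k X))
           λ { {l , r} _ → when-no (isQcan? [] (node l m r)) (isQcan-[] {l} {m} {r}) })))
        (+-identityʳ _)

    private
      module _ {y Y} (d : Descending (y ∷ Y)) (g : BinaryPlaneTree → Carrier) where

        summand : BinaryPlaneTree → BinaryPlaneTree → List ℕ × List ℕ → Carrier
        summand l r (A , B) =
          when (does (isQcan? A l)) (when (does (isQcan? B r))
            (when (does (rootCondition? l r)) (g (node l y r))))

        indicator : ∀ l r → when (does (isQcan? (y ∷ Y) (node l y r))) (g (node l y r)) ≈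
                            ∑ (splits Y) (summand l r)
        indicator l r = begin
          when (does (isQcan? (y ∷ Y) (node l y r))) (g (node l y r))
            ≈⟨ when-⇔ (isQcan-node d) (isQcan? (y ∷ Y) (node l y r))
                 (isQcan? A₀ l ×-dec isQcan? B₀ r ×-dec rootCondition? l r) ⟩
          when (does (isQcan? A₀ l ×-dec isQcan? B₀ r ×-dec rootCondition? l r)) (g (node l y r))
            ≡⟨ when-∧ (does (isQcan? A₀ l)) (does (isQcan? B₀ r ×-dec rootCondition? l r)) _ ⟩
          when (does (isQcan? A₀ l)) (when (does (isQcan? B₀ r ×-dec rootCondition? l r)) (g (node l y r)))
            ≡⟨ cong (when (does (isQcan? A₀ l))) (when-∧ (does (isQcan? B₀ r)) (does (rootCondition? l r)) _) ⟩
          summand l r (A₀ , B₀)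
            ≈⟨ ∑-splits-filter (_∈? inorder l) Y (summand l r) separated ⟨
          ∑ (splits Y) (summand l r) ∎
          where
          A₀ B₀ : List ℕ
          A₀ = filter (_∈? inorder l) Y
          B₀ = filter (¬? ∘ (_∈? inorder l)) Y
          separated : ∀ {A B} → Interleaving A B Y → summand l r (A , B) ≈ 0# ⊎
                      (All (_∈ inorder l) A × All (_∉ inorder l) B)
          separated {A} {B} i = by-cases (isQcan? A l) (isQcan? B r)
            where
            by-cases : Dec (IsQcan A l) → Dec (IsQcan B r) → _
            by-cases (yes qA) (yes qB) = inj₂ (isQcan-separates {r = r} (AllPairs.tail d) i qA qB)
            by-cases (no ¬qA) _        = inj₁ (when-no (isQcan? A l) ¬qA)
            by-cases (yes _)  (no ¬qB) = inj₁
                (≈-trans (when-cong (does (isQcan? A l)) λ _ → when-no (isQcan? B r) ¬qB)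
                                                       (when-0 (does (isQcan? A l))))

        indicator-root : ∀ l m r → when (does (isQcan? (y ∷ Y) (node l m r))) (g (node l m r)) ≈
                                   when (does (m ≟ y)) (∑ (splits Y) (summand l r))
        indicator-root l m r = by-root (m ≟ y)
          where
          by-root : (m≟y : Dec (m ≡ y)) →
                    when (does (isQcan? (y ∷ Y) (node l m r))) (g (node l m r)) ≈
                    when (does m≟y) (∑ (splits Y) (summand l r))
          by-root (yes refl) = indicator l r
          by-root (no m≢y)   = when-no (isQcan? (y ∷ Y) (node l m r)) (m≢y ∘ isQcan-root {l = l} {r = r} d)

    ∑-trees≤-∷ : ∀ k {y Y} → Valid (y ∷ Y) → ∀ g →
      ∑ (trees≤ (suc k) (y ∷ Y)) g ≈
      ∑ (splits Y) λ (A , B) → ∑ (trees≤ k A) λ l → ∑ (trees≤ k B) λ r →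
        when (does (rootCondition? l r)) (g (node l y r))
    ∑-trees≤-∷ k {y} {Y} (d , y∈X ∷ _) g = begin
      ∑ (trees≤ (suc k) (y ∷ Y)) g
        ≈⟨ ∑-filter (isQcan? (y ∷ Y)) (treesUpTo (suc k) X) g ⟩
      when (does (isQcan? (y ∷ Y) ∅)) (g ∅) + ∑ (cartesianProductWith _ X (cartesianProduct S S)) _
        ≈⟨ +-cong (when-no (isQcan? (y ∷ Y) ∅) isQcan-∷-leaf {g ∅})
            (∑-cartesianProductWith _ X (cartesianProduct S S) _) ⟩
      0# + ∑ X (λ m → ∑ (cartesianProduct S S) λ (l , r) → term m l r)
        ≈⟨ +-identityˡ _ ⟩
      ∑ X (λ m → ∑ (cartesianProduct S S) λ (l , r) → term m l r)
        ≈⟨ ∑-cong X (λ m → ∑-cong (cartesianProduct S S) λ (l , r) → indicator-root d g l m r) ⟩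
      ∑ X (λ m → ∑ (cartesianProduct S S) λ (l , r) → when (does (m ≟ y)) (∑ (splits Y) (summand d g l r)))
        ≈⟨ ∑-cong X (λ m → ∑-when (cartesianProduct S S) (does (m ≟ y)) _) ⟩
      ∑ X (λ m → when (does (m ≟ y)) (∑ (cartesianProduct S S) λ (l , r) → ∑ (splits Y) (summand d g l r)))
        ≈⟨ ∑-unique _≟_ _ X! y∈X ⟩
      ∑ (cartesianProduct S S) (λ (l , r) → ∑ (splits Y) (summand d g l r))
        ≈⟨ ∑-swap (cartesianProduct S S) (splits Y) _ ⟩
      ∑ (splits Y) (λ p → ∑ (cartesianProduct S S) λ (l , r) → summand d g l r p)
        ≈⟨ ∑-cong (splits Y) (λ p → ∑-cartesianProductWith _,_ S S _) ⟩
      ∑ (splits Y) (λ p → ∑ S λ l → ∑ S λ r → summand d g l r p)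
        ≈⟨ ∑-cong (splits Y) (λ (A , B) → ∑-cong S λ l → ∑-when S (does (isQcan? A l)) _) ⟩
      ∑ (splits Y) (λ (A , B) → ∑ S λ l → when (does (isQcan? A l)) (∑ S λ r → when (does (isQcan? B r))
        (when (does (rootCondition? l r)) (g (node l y r)))))
        ≈⟨ ∑-cong (splits Y) (λ (A , B) → ∑-filter (isQcan? A) S _) ⟨
      ∑ (splits Y) (λ (A , B) → ∑ (trees≤ k A) λ l → ∑ S λ r → when (does (isQcan? B r))
        (when (does (rootCondition? l r)) (g (node l y r))))
        ≈⟨ ∑-cong (splits Y) (λ (A , B) → ∑-cong (trees≤ k A) λ l → ∑-filter (isQcan? B) S _) ⟨
      ∑ (splits Y) (λ (A , B) → ∑ (trees≤ k A) λ l → ∑ (trees≤ k B) λ r →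
        when (does (rootCondition? l r)) (g (node l y r))) ∎
      where
      S = treesUpTo k X
      term : ℕ → BinaryPlaneTree → BinaryPlaneTree → Carrier
      term m l r = when (does (isQcan? (y ∷ Y) (node l m r))) (g (node l m r))

    -- Removing the root of a tree on `y ∷ Y` leaves subtrees whose height bound is `length Y`, not
    -- the number of their own labels; this lemma restores the latter.
    ∑-trees≤-height : ∀ k k′ {Y} → Valid Y → length Y ≤ k → length Y ≤ k′ → ∀ g →
                      ∑ (trees≤ k Y) g ≈ ∑ (trees≤ k′ Y) g
    ∑-trees≤-height k k′ {[]} _ _ _ g = ≈-trans (∑-trees-[] k g) (≈-sym (∑-trees-[] k′ g))
    ∑-trees≤-height (suc k) (suc k′) {y ∷ Y} v (s≤s p) (s≤s p′) g = begin
      _ ≈⟨ ∑-trees≤-∷ k v g ⟩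
      _ ≈⟨ ∑-cong-∈ (splits Y) (λ s → step (splits⇒interleaving Y s)) ⟩
      _ ≈⟨ ∑-trees≤-∷ k′ v g ⟨
      _ ∎
      where
      step : ∀ {A B} → Interleaving A B Y → _
      step {A} {B} i with vA , vB ← valid-interleaving i (valid-tail v) | A≤ , B≤ ← interleaving-length i =
        ≈-trans (∑-trees≤-height k k′ vA (≤-trans A≤ p) (≤-trans A≤ p′) _)
          (∑-cong (trees≤ k′ A) λ l → ∑-trees≤-height k k′ vB (≤-trans B≤ p) (≤-trans B≤ p′) _)

    ∑-trees-∷ : ∀ {y Y} → Valid (y ∷ Y) → ∀ g →
      ∑ (trees (y ∷ Y)) g ≈
      ∑ (trees Y) (λ r → g (node ∅ y r)) +
      ∑ (splits Y) λ (A , B) → ∑ (trees A) λ l → ∑ (trees B) λ r →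
        when (below (firstPost r) A) (g (node l y r))
    ∑-trees-∷ {y} {Y} v g = begin
      ∑ (trees (y ∷ Y)) g
        ≈⟨ ∑-trees≤-∷ (length Y) v g ⟩
      ∑ (splits Y) (λ (A , B) → ∑ (trees≤ (length Y) A) λ l → ∑ (trees≤ (length Y) B) λ r →
        when (does (rootCondition? l r)) (g (node l y r)))
        ≈⟨ ∑-cong-∈ (splits Y)
            (λ s → ≈-trans (height (splits⇒interleaving Y s)) (separate (splits⇒interleaving Y s))) ⟩
      ∑ (splits Y) (λ p → noLeft p + withLeft p)
        ≈⟨ ∑-+ (splits Y) noLeft withLeft ⟩
      ∑ (splits Y) noLeft + ∑ (splits Y) withLeft
        ≈⟨ +-congʳ (∑-splits-[]ˡ Y noLeft (λ _ → ≈-refl)) ⟩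
      ∑ (trees Y) (λ r → g (node ∅ y r)) + ∑ (splits Y) withLeft ∎
      where
      -- For an empty left label list the root condition is vacuous, while `below` is false; roots
      -- without left child therefore get a term of their own.
      noLeft withLeft : List ℕ × List ℕ → Carrier
      noLeft ([]    , B) = ∑ (trees B) λ r → g (node ∅ y r)
      noLeft (_ ∷ _ , B) = 0#
      withLeft (A , B) = ∑ (trees A) λ l → ∑ (trees B) λ r → when (below (firstPost r) A) (g (node l y r))

      height : ∀ {A B} → Interleaving A B Y →
        ∑ (trees≤ (length Y) A) (λ l → ∑ (trees≤ (length Y) B) λ r →
          when (does (rootCondition? l r)) (g (node l y r))) ≈
        ∑ (trees A) (λ l → ∑ (trees B) λ r → when (does (rootCondition? l r)) (g (node l y r)))
      height {A} {B} i with vA , vB ← valid-interleaving i (valid-tail v) | A≤ , B≤ ← interleaving-length i =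
        ≈-trans (∑-trees≤-height (length Y) (length A) vA A≤ ≤-refl _)
          (∑-cong (trees A) λ l → ∑-trees≤-height (length Y) (length B) vB B≤ ≤-refl _)

      separate : ∀ {A B} → Interleaving A B Y →
        ∑ (trees A) (λ l → ∑ (trees B) λ r → when (does (rootCondition? l r)) (g (node l y r))) ≈
        noLeft (A , B) + withLeft (A , B)
      separate {[]} {B} i =
        ≈-trans (∑-trees-[] 0 (λ l → ∑ (trees B) λ r → when (does (rootCondition? l r)) (g (node l y r))))
          (≈-trans (≈-sym (+-identityʳ _)) (+-congˡ (≈-sym
          (∑-zero (trees []) λ _ → ∑-0 (trees B)))))
      -- The left child carries the head of the left label list, so the root condition depends on
      -- `l` only through its labels.
      separate {a ∷ A} {B} i = ≈-trans
        (∑-cong-∈ (trees (a ∷ A)) λ {l} l∈ → ∑-cong (trees B) λ r →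
          reflexive (cong (λ b → when b (g (node l y r)))
            (cong (λ x → does (MaybeAll.dec (λ b → MaybeAny.dec (_<? b) (firstPost r)) x))
              (root≡head {t = l} (proj₁ (proj₁ (valid-interleaving i (valid-tail v))))
                  (trees≤-IsQcan {length (a ∷ A)} l∈)))))
        (≈-sym (+-identityˡ _))

    -- The weighted sums Φ and the admissibility defect

    module Weights (a : ℕ → Carrier) where

      -- wt h t = h q₀ * a q₁ * ⋯ * a qₚ for quasicanonical t with 𝐪 t = (q₀, …, qₚ).
      wt : (ℕ → Carrier) → BinaryPlaneTree → Carrier
      wt h ∅                        = h 0
      wt h (node ∅ _ r)             = wt (h ∘ suc) r
      wt h (node l@(node _ _ _) _ r) = wt h l * wt a r

      wt-cong : ∀ {h h′} → (∀ k → h k ≈ h′ k) → ∀ t → wt h t ≈ wt h′ t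
      wt-cong eq ∅                         = eq 0
      wt-cong eq (node ∅ _ r)              = wt-cong (eq ∘ suc) r
      wt-cong eq (node l@(node _ _ _) _ r) = *-congʳ (wt-cong eq l)

      wt-linear : ∀ x h h′ t → wt (λ k → x * h k + h′ k) t ≈ x * wt h t + wt h′ t
      wt-linear x h h′ ∅                         = ≈-refl
      wt-linear x h h′ (node ∅ _ r)              = wt-linear x (h ∘ suc) (h′ ∘ suc) r
      wt-linear x h h′ (node l@(node _ _ _) _ r) =
        ≈-trans (*-congʳ (wt-linear x h h′ l)) (≈-trans (distribʳ _ _ _) (+-congʳ (*-assoc _ _ _)))

      wt-node : ∀ {y Y l} → IsQcan (y ∷ Y) l → ∀ h m r → wt h (node l m r) ≈ wt h l * wt a r
      wt-node {l = ∅}          q h m r = ⊥-elim (isQcan-∷-leaf q)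
      wt-node {l = node _ _ _} q h m r = ≈-refl

      Φ : (ℕ → Carrier) → List ℕ → Carrier
      Φ h Y = ∑ (trees Y) (wt h)

      Φ-linear : ∀ x h h′ Y → Φ (λ k → x * h k + h′ k) Y ≈ x * Φ h Y + Φ h′ Y
      Φ-linear x h h′ Y = ≈-trans (∑-cong (trees Y) (wt-linear x h h′))
        (≈-trans (∑-+ (trees Y) _ _) (+-congʳ (∑-*ˡ (trees Y) x _)))

      -- The sum over the left trees is already carried out as `Φ h A`, because admissibility sees
      -- only the labels of `l`.
      admissible : (ℕ → Carrier) → List ℕ × List ℕ → Carrier
      admissible h (A , B) = ∑ (trees B) λ r → when (below (firstPost r) A) (Φ h A) * wt a r

      -- The separate sequence `b` for the first gap of `r` is needed for induction: it starts as
      -- `a` and is shifted whenever a root without left child is peeled off `r`.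
      inadmissible : (ℕ → Carrier) → (ℕ → Carrier) → List ℕ × List ℕ → Carrier
      inadmissible b h (A , B) = ∑ (trees A) λ l → ∑ (trees B) λ r →
        when (not (below (firstPost r) A)) (wt h l * wt b r)

      private
        wt-when : ∀ {A l} → IsQcan A l → ∀ f h m r →
          when (below f A) (wt h (node l m r)) ≈ when (below f A) (wt h l * wt a r)
        wt-when {[]}        q f h m r = ≈-refl
        wt-when {x ∷ A} {l} q f h m r = when-cong (below f (x ∷ A)) λ _ → wt-node {l = l} q h m r

      Φ-∷-admissible : ∀ {y Y} → Valid (y ∷ Y) → ∀ h → Φ h (y ∷ Y) ≈ Φ (h ∘ suc) Y + ∑ (splits Y) (admissible h)
      Φ-∷-admissible {y} {Y} v h = ≈-trans (∑-trees-∷ v (wt h)) (+-congˡ (∑-cong (splits Y) λ (A , B) → begin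
        ∑ (trees A) (λ l → ∑ (trees B) λ r → when (below (firstPost r) A) (wt h (node l y r)))
          ≈⟨ ∑-cong-∈ (trees A)
              (λ {l} l∈ → ∑-cong (trees B) λ r → wt-when {l = l} (trees≤-IsQcan {length A} l∈)
                  (firstPost r) h y r) ⟩
        ∑ (trees A) (λ l → ∑ (trees B) λ r → when (below (firstPost r) A) (wt h l * wt a r))
          ≈⟨ ∑-swap (trees A) (trees B) _ ⟩
        ∑ (trees B) (λ r → ∑ (trees A) λ l → when (below (firstPost r) A) (wt h l * wt a r))
          ≈⟨ ∑-cong (trees B) (λ r → ∑-cong (trees A) λ l → when-*ʳ (below (firstPost r) A) (wt h l) (wt a r)) ⟨
        ∑ (trees B) (λ r → ∑ (trees A) λ l → when (below (firstPost r) A) (wt h l) * wt a r)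
          ≈⟨ ∑-cong (trees B) (λ r → ≈-trans (∑-*ʳ (trees A) (wt a r) _)
              (*-congʳ (∑-when (trees A) (below (firstPost r) A) (wt h)))) ⟩
        admissible h (A , B) ∎))

      admissible+inadmissible : ∀ h p → admissible h p + inadmissible a h p ≈ Φ h (proj₁ p) * Φ a (proj₂ p)
      admissible+inadmissible h (A , B) = begin
        admissible h (A , B) + inadmissible a h (A , B)
          ≈⟨ +-congˡ (∑-swap (trees A) (trees B) _) ⟩
        admissible h (A , B) +
            ∑ (trees B) (λ r → ∑ (trees A) λ l → when (not (below (firstPost r) A)) (wt h l * wt a r))
          ≈⟨ ∑-+ (trees B) _ _ ⟨
        ∑ (trees B) (λ r → when (below (firstPost r) A) (Φ h A) * wt a r +
          ∑ (trees A) λ l → when (not (below (firstPost r) A)) (wt h l * wt a r))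
          ≈⟨ ∑-cong (trees B) (λ r → +-cong (when-*ʳ (below (firstPost r) A) _ _)
               (≈-trans (∑-when (trees A) (not (below (firstPost r) A)) _)
                   (when-cong (not (below (firstPost r) A)) λ _ → ∑-*ʳ (trees A) (wt a r) (wt h)))) ⟩
        ∑ (trees B) (λ r → when (below (firstPost r) A) (Φ h A * wt a r) +
                           when (not (below (firstPost r) A)) (Φ h A * wt a r))
          ≈⟨ ∑-cong (trees B) (λ r → when-not (below (firstPost r) A) _) ⟩
        ∑ (trees B) (λ r → Φ h A * wt a r)
          ≈⟨ ∑-*ˡ (trees B) _ _ ⟩
        Φ h A * Φ a B ∎

      not-below-nothing : ∀ A x → when (not (below nothing A)) x ≈ x
      not-below-nothing A x = reflexive (cong (λ b → when (not b) x) (below-nothing A))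

      inadmissible-[]ʳ : ∀ b h U → inadmissible b h (U , []) ≈ b 0 * Φ h U
      inadmissible-[]ʳ b h U = begin
        inadmissible b h (U , [])
          ≈⟨ ∑-cong (trees U) (λ l → ∑-trees-[] 0 λ r → when (not (below (firstPost r) U)) (wt h l * wt b r)) ⟩
        ∑ (trees U) (λ l → when (not (below nothing U)) (wt h l * b 0))
          ≈⟨ ∑-cong (trees U) (λ l → ≈-trans (not-below-nothing U (wt h l * b 0)) (*-comm (wt h l) (b 0))) ⟩
        ∑ (trees U) (λ l → b 0 * wt h l)
          ≈⟨ ∑-*ˡ (trees U) (b 0) (wt h) ⟩
        b 0 * Φ h U ∎

      below-max : ∀ {y B A b r} → Descending (y ∷ b ∷ B) → IsQcan (b ∷ B) r → below (firstPost r) (y ∷ A) ≡ true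
      below-max {y} {r = r} (y> ∷ _) q with f , eq , f∈ ← firstPost-just {t = r} q rewrite eq =
        dec-true (f <? y) (All.lookup y> f∈)

      -- With the largest label in the left tree, every nonempty right tree starts below it in
      -- postorder, so only the empty right tree is inadmissible.
      inadmissible-∷ˡ : ∀ b h {y Y} → Valid (y ∷ Y) →
        ∑ (splits Y) (λ (A , B) → inadmissible b h (y ∷ A , B)) ≈ b 0 * Φ h (y ∷ Y)
      inadmissible-∷ˡ b h {y} {Y} v = ≈-trans (∑-splits-[]ʳ Y _ vanish) (inadmissible-[]ʳ b h (y ∷ Y))
        where
        vanish : ∀ {A x B} → Interleaving A (x ∷ B) Y → inadmissible b h (y ∷ A , x ∷ B) ≈ 0#
        vanish {A} {x} {B} i = ∑-zero (trees (y ∷ A)) λ {l} _ → ∑-zero (trees (x ∷ B)) λ {r} r∈ →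
          reflexive (cong (λ t → when (not t) (wt h l * wt b r))
            (below-max {A = A} {r = r} (proj₁ (proj₂ (valid-interleaving (consʳ i) v)))
                (trees≤-IsQcan {length (x ∷ B)} r∈)))

      ∑∑-when : ∀ (S T : List BinaryPlaneTree) q (f : BinaryPlaneTree → BinaryPlaneTree → Carrier) →
        ∑ S (λ l → ∑ T λ r → when q (f l r)) ≈ when q (∑ S λ l → ∑ T (f l))
      ∑∑-when S T q f = ≈-trans (∑-cong S λ l → ∑-when T q (f l)) (∑-when S q _)

      -- Here `y` is the root of the right tree. Without a left child it hands the inequality on to
      -- its right subtree and adds one to the first gap. With a left subtree `l₁` on `C`, the first
      -- postorder entry is that of `l₁`, so the inequality against `A` moves to `l₁`, and the right
      -- subtree on `E` contributes the weight `a` and the root condition against `C`.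
      inadmissible-∷ʳ : ∀ b h {A B y} → All (_< y) A → Valid (y ∷ B) →
        inadmissible b h (A , y ∷ B) ≈
        inadmissible (b ∘ suc) h (A , B) +
        ∑ (splits B) λ (C , E) → ∑ (trees E) λ r → when (below (firstPost r) C)
            (inadmissible b h (A , C)) * wt a r
      inadmissible-∷ʳ b h {A} {B} {y} A<y v = begin
        inadmissible b h (A , y ∷ B)
          ≈⟨ ∑-cong (trees A) (λ l → ∑-trees-∷ v (F l)) ⟩
        ∑ (trees A) (λ l → ∑ (trees B) (λ r → F l (node ∅ y r)) +
          ∑ (splits B) λ (C , E) → ∑ (trees C) λ l₁ → ∑ (trees E) λ r → when (below (firstPost r) C)
              (F l (node l₁ y r)))
          ≈⟨ ∑-+ (trees A) _ _ ⟩
        ∑ (trees A) (λ l → ∑ (trees B) (λ r → F l (node ∅ y r))) +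
        ∑ (trees A) (λ l → ∑ (splits B) λ (C , E) → ∑ (trees C) λ l₁ → ∑ (trees E) λ r →
          when (below (firstPost r) C) (F l (node l₁ y r)))
          ≈⟨ +-cong (∑-cong (trees A) λ l → ∑-cong (trees B) λ r →
                      reflexive (cong (λ t → when (not t) (wt h l * wt (b ∘ suc) r)) (below-leafˡ {r = r} A<y)))
                    (∑-swap (trees A) (splits B) _) ⟩
        inadmissible (b ∘ suc) h (A , B) +
        ∑ (splits B) (λ (C , E) → ∑ (trees A) λ l → ∑ (trees C) λ l₁ → ∑ (trees E) λ r →
          when (below (firstPost r) C) (F l (node l₁ y r)))
          ≈⟨ +-congˡ (∑-cong (splits B) λ (C , E) → inner C E) ⟩
        inadmissible (b ∘ suc) h (A , B) +
        ∑ (splits B) (λ (C , E) → ∑ (trees E) λ r → when (below (firstPost r) C)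
            (inadmissible b h (A , C)) * wt a r) ∎
        where
        F : BinaryPlaneTree → BinaryPlaneTree → Carrier
        F l r = when (not (below (firstPost r) A)) (wt h l * wt b r)

        step : ∀ {C l₁} → IsQcan C l₁ → ∀ l r → when (below (firstPost r) C) (F l (node l₁ y r)) ≈
          when (below (firstPost r) C) (when (not (below (firstPost l₁) A)) (wt h l * wt b l₁)) * wt a r
        step {[]} q l r = ≈-sym (zeroˡ (wt a r))
        step {c ∷ C} {l₁} q l r with f , eq , _ ← firstPost-just {t = l₁} q = ≈-trans
          (when-cong (below (firstPost r) (c ∷ C)) λ _ → ≈-trans
            (reflexive (cong₂ (λ x z → when (not (below x A)) z)
                          (trans (firstPost-left {l₁} y r eq) (sym eq)) refl))
            (≈-trans (when-cong (not (below (firstPost l₁) A)) λ _ →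
                       ≈-trans (*-congˡ (wt-node {l = l₁} q b y r)) (≈-sym (*-assoc _ _ _)))
                     (≈-sym (when-*ʳ (not (below (firstPost l₁) A)) _ _))))
          (≈-sym (when-*ʳ (below (firstPost r) (c ∷ C)) _ _))

        inner : ∀ C E →
          ∑ (trees A) (λ l → ∑ (trees C) λ l₁ → ∑ (trees E) λ r → when (below (firstPost r) C)
              (F l (node l₁ y r))) ≈
          ∑ (trees E) (λ r → when (below (firstPost r) C) (inadmissible b h (A , C)) * wt a r)
        inner C E = begin
          ∑ (trees A) (λ l → ∑ (trees C) λ l₁ → ∑ (trees E) λ r → when (below (firstPost r) C)
              (F l (node l₁ y r)))
            ≈⟨ ∑-cong (trees A) (λ l → ∑-cong-∈ (trees C) λ {l₁} l₁∈ → ∑-cong (trees E) λ r →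
                 step {l₁ = l₁} (trees≤-IsQcan {length C} l₁∈) l r) ⟩
          ∑ (trees A) (λ l → ∑ (trees C) λ l₁ → ∑ (trees E) λ r → G r l l₁ * wt a r)
            ≈⟨ ∑-cong (trees A) (λ l → ∑-swap (trees C) (trees E) _) ⟩
          ∑ (trees A) (λ l → ∑ (trees E) λ r → ∑ (trees C) λ l₁ → G r l l₁ * wt a r)
            ≈⟨ ∑-swap (trees A) (trees E) _ ⟩
          ∑ (trees E) (λ r → ∑ (trees A) λ l → ∑ (trees C) λ l₁ → G r l l₁ * wt a r)
            ≈⟨ ∑-cong (trees E) (λ r → ≈-trans (∑-cong (trees A) λ l → ∑-*ʳ (trees C) (wt a r) (G r l))
                 (∑-*ʳ (trees A) (wt a r) _)) ⟩
          ∑ (trees E) (λ r → ∑ (trees A) (λ l → ∑ (trees C) λ l₁ → G r l l₁) * wt a r)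
            ≈⟨ ∑-cong (trees E) (λ r → *-congʳ (∑∑-when (trees A) (trees C) (below (firstPost r) C) _)) ⟩
          ∑ (trees E) (λ r → when (below (firstPost r) C) (inadmissible b h (A , C)) * wt a r) ∎
          where
          G : BinaryPlaneTree → BinaryPlaneTree → BinaryPlaneTree → Carrier
          G r l l₁ = when (below (firstPost r) C) (when (not (below (firstPost l₁) A)) (wt h l * wt b l₁))

      -- For C nonempty the heads of C and U agree whenever the summand is nonzero; the split with C
      -- empty, where below f C fails, is supplied by the second term on the left.
      inadmissible-graft : ∀ b h f {U} → Descending U →
        ∑ (splits U) (λ (A , C) → when (below f C) (inadmissible b h (A , C))) +
            when (below f U) (b 0 * Φ h U) ≈
        when (below f U) (∑ (splits U) (inadmissible b h))
      inadmissible-graft b h f {U} d = begin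
        ∑ (splits U) grafted + when (below f U) (b 0 * Φ h U)
          ≈⟨ +-congˡ (when-cong (below f U) λ _ → inadmissible-[]ʳ b h U) ⟨
        ∑ (splits U) grafted + lost (U , [])
          ≈⟨ +-congˡ (∑-splits-[]ʳ U lost (λ _ → ≈-refl)) ⟨
        ∑ (splits U) grafted + ∑ (splits U) lost
          ≈⟨ ∑-+ (splits U) grafted lost ⟨
        ∑ (splits U) (λ p → grafted p + lost p)
          ≈⟨ ∑-cong-∈ (splits U) (split ∘ splits⇒interleaving U) ⟩
        ∑ (splits U) (λ p → when (below f U) (inadmissible b h p))
          ≈⟨ ∑-when (splits U) (below f U) (inadmissible b h) ⟩
        when (below f U) (∑ (splits U) (inadmissible b h)) ∎
        where
        grafted lost : List ℕ × List ℕ → Carrier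
        grafted (A , C) = when (below f C) (inadmissible b h (A , C))
        lost (A , [])    = when (below f U) (inadmissible b h (A , []))
        lost (A , _ ∷ _) = 0#
        split : ∀ {A C} → Interleaving A C U →
            grafted (A , C) + lost (A , C) ≈ when (below f U) (inadmissible b h (A , C))
        split {A} {[]}    i = +-identityˡ _
        split {A} {c ∷ C} i = ≈-trans (+-identityʳ _) (begin
          when (below f (c ∷ C)) (inadmissible b h (A , c ∷ C))
            ≈⟨ ∑∑-when (trees A) (trees (c ∷ C)) (below f (c ∷ C)) _ ⟨
          ∑ (trees A) (λ l → ∑ (trees (c ∷ C)) λ r → when (below f (c ∷ C))
              (when (not (below (firstPost r) A)) (wt h l * wt b r)))
            ≈⟨ ∑-cong (trees A) (λ l → ∑-cong-∈ (trees (c ∷ C)) λ {r} r∈ → heads l r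
                (trees≤-IsQcan {length (c ∷ C)} r∈)) ⟩
          ∑ (trees A) (λ l → ∑ (trees (c ∷ C)) λ r → when (below f U)
              (when (not (below (firstPost r) A)) (wt h l * wt b r)))
            ≈⟨ ∑∑-when (trees A) (trees (c ∷ C)) (below f U) _ ⟩
          when (below f U) (inadmissible b h (A , c ∷ C)) ∎)
          where
          heads : ∀ l r → IsQcan (c ∷ C) r →
            when (below f (c ∷ C)) (when (not (below (firstPost r) A)) (wt h l * wt b r)) ≈
            when (below f U) (when (not (below (firstPost r) A)) (wt h l * wt b r))
          heads l r q = ≈-trans (when-comm (below f (c ∷ C)) (not (below (firstPost r) A)) _)
            (≈-trans (when-cong (not (below (firstPost r) A)) λ eq →
                       reflexive (cong (λ t → when t _) (not-below⇒head {l = r} d i q eq)))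
                     (when-comm (not (below (firstPost r) A)) (below f U) _))

      -- Cutting and reattaching is not built as a map. Instead both sides satisfy the same
      -- recursion when the largest label is removed: it lies in the left tree (the cut above the
      -- whole tree, weight `b 0`), or it is the root of the right tree with or without a left
      -- child.
      Φ-convolve : ∀ n b h {Y} → length Y ≤ n → Valid Y → ∑ (splits Y) (inadmissible b h) ≈ Φ (convolve b h) Y
      Φ-convolve n b h {[]} _ _ = begin
        inadmissible b h ([] , []) + 0#      ≈⟨ +-identityʳ _ ⟩
        inadmissible b h ([] , [])           ≈⟨ inadmissible-[]ʳ b h [] ⟩
        b 0 * Φ h []                ≈⟨ *-congˡ (∑-trees-[] 0 (wt h)) ⟩
        b 0 * h 0                   ≈⟨ ∑-trees-[] 0 (wt (convolve b h)) ⟨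
        Φ (convolve b h) []         ∎
      Φ-convolve (suc n) b h {y ∷ Y} (s≤s p) v@(d@(y> ∷ _) , _) = begin
        ∑ (splits (y ∷ Y)) (inadmissible b h)
          ≈⟨ ∑-splits-∷ y Y (inadmissible b h) ⟩
        ∑ (splits Y) (λ (A , B) → inadmissible b h (y ∷ A , B)) +
            ∑ (splits Y) (λ (A , B) → inadmissible b h (A , y ∷ B))
          ≈⟨ +-cong (inadmissible-∷ˡ b h v) (∑-cong-∈ (splits Y) λ s → let i = splits⇒interleaving Y s in
               inadmissible-∷ʳ b h (proj₁ (interleaving-All i y>)) (proj₂ (valid-interleaving (consʳ i) v))) ⟩
        b 0 * Φ h (y ∷ Y) +
            ∑ (splits Y) (λ (A , B) → inadmissible (b ∘ suc) h (A , B) + ∑ (splits B) λ (C , E) → G A C E)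
          ≈⟨ +-congˡ (≈-trans (∑-+ (splits Y) _ _)
              (+-cong (Φ-convolve n (b ∘ suc) h p (valid-tail v)) (∑-splits-assoc Y G))) ⟩
        b 0 * Φ h (y ∷ Y) +
            (Φ (convolve (b ∘ suc) h) Y + ∑ (splits Y) λ (U , E) → ∑ (splits U) λ (A , C) → G A C E)
          -- The cut with nothing above it is unfolded as well: its first part supplies the leading
          -- term of `convolve b h ∘ suc`, its second the grafts with empty `C` that
          -- `inadmissible-graft` asks for.
          ≈⟨ +-congʳ (≈-trans (*-congˡ (Φ-∷-admissible v h)) (distribˡ _ _ _)) ⟩
        (b 0 * Φ (h ∘ suc) Y + b 0 * ∑ (splits Y) (admissible h)) +
        (Φ (convolve (b ∘ suc) h) Y + ∑ (splits Y) λ (U , E) → ∑ (splits U) λ (A , C) → G A C E)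
          ≈⟨ +-interchange _ _ _ _ ⟩
        (b 0 * Φ (h ∘ suc) Y + Φ (convolve (b ∘ suc) h) Y) +
        (b 0 * ∑ (splits Y) (admissible h) + ∑ (splits Y) λ (U , E) → ∑ (splits U) λ (A , C) → G A C E)
          ≈⟨ +-cong (≈-sym (Φ-linear (b 0) (h ∘ suc) (convolve (b ∘ suc) h) Y))
                    (≈-trans (+-congʳ (≈-sym (∑-*ˡ (splits Y) (b 0) (admissible h))))
                        (≈-sym (∑-+ (splits Y) _ _))) ⟩
        Φ (convolve b h ∘ suc) Y +
            ∑ (splits Y) (λ (U , E) → b 0 * admissible h (U , E) + ∑ (splits U) λ (A , C) → G A C E)
          ≈⟨ +-congˡ (∑-cong-∈ (splits Y) λ s → regraft (splits⇒interleaving Y s)) ⟩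
        Φ (convolve b h ∘ suc) Y + ∑ (splits Y) (admissible (convolve b h))
          ≈⟨ Φ-∷-admissible v (convolve b h) ⟨
        Φ (convolve b h) (y ∷ Y) ∎
        where
        G : List ℕ → List ℕ → List ℕ → Carrier
        G A C E = ∑ (trees E) λ r → when (below (firstPost r) C) (inadmissible b h (A , C)) * wt a r

        regraft : ∀ {U E} → Interleaving U E Y →
          b 0 * admissible h (U , E) + ∑ (splits U) (λ (A , C) → G A C E) ≈ admissible (convolve b h) (U , E)
        regraft {U} {E} i with vU , _ ← valid-interleaving i (valid-tail v) = begin
          b 0 * admissible h (U , E) + ∑ (splits U) (λ (A , C) → G A C E)
            ≈⟨ +-cong (≈-sym (∑-*ˡ (trees E) (b 0) _)) (∑-swap (splits U) (trees E) _) ⟩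
          ∑ (trees E) (λ r → b 0 * (when (below (firstPost r) U) (Φ h U) * wt a r)) +
          ∑ (trees E) (λ r → ∑ (splits U) λ (A , C) → when (below (firstPost r) C)
              (inadmissible b h (A , C)) * wt a r)
            ≈⟨ ∑-+ (trees E) _ _ ⟨
          ∑ (trees E) (λ r → b 0 * (when (below (firstPost r) U) (Φ h U) * wt a r) +
            ∑ (splits U) λ (A , C) → when (below (firstPost r) C) (inadmissible b h (A , C)) * wt a r)
            ≈⟨ ∑-cong (trees E) (λ r → collect r (firstPost r)) ⟩
          ∑ (trees E) (λ r → when (below (firstPost r) U) (∑ (splits U) (inadmissible b h)) * wt a r)
            ≈⟨ ∑-cong (trees E) (λ r → *-congʳ (when-cong (below (firstPost r) U) λ _ →
                 Φ-convolve n b h (≤-trans (proj₁ (interleaving-length i)) p) vU)) ⟩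
          admissible (convolve b h) (U , E) ∎
          where
          collect : ∀ r f →
            b 0 * (when (below f U) (Φ h U) * wt a r) +
            ∑ (splits U) (λ (A , C) → when (below f C) (inadmissible b h (A , C)) * wt a r) ≈
            when (below f U) (∑ (splits U) (inadmissible b h)) * wt a r
          collect r f = begin
            b 0 * (when (below f U) (Φ h U) * wt a r) +
            ∑ (splits U) (λ (A , C) → when (below f C) (inadmissible b h (A , C)) * wt a r)
              ≈⟨ +-cong (≈-sym (*-assoc _ _ _)) (∑-*ʳ (splits U) (wt a r) _) ⟩
            b 0 * when (below f U) (Φ h U) * wt a r +
            ∑ (splits U) (λ (A , C) → when (below f C) (inadmissible b h (A , C))) * wt a r
              ≈⟨ distribʳ _ _ _ ⟨
            (b 0 * when (below f U) (Φ h U) +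
                ∑ (splits U) (λ (A , C) → when (below f C) (inadmissible b h (A , C)))) * wt a r
              ≈⟨ *-congʳ (≈-trans (+-comm _ _) (+-congˡ (when-*ˡ (below f U) _ _))) ⟩
            (∑ (splits U) (λ (A , C) → when (below f C) (inadmissible b h (A , C))) +
                when (below f U) (b 0 * Φ h U)) * wt a r
              ≈⟨ *-congʳ (inadmissible-graft b h f (proj₁ vU)) ⟩
            when (below f U) (∑ (splits U) (inadmissible b h)) * wt a r ∎

      -- Adding the inadmissible pairs on both sides completes the admissible ones to all pairs of
      -- trees, that is, to a product of two independent sums.
      Φ-∷ : ∀ h {y Y} → Valid (y ∷ Y) →
        Φ h (y ∷ Y) + Φ (convolve a h) Y ≈ Φ (h ∘ suc) Y + ∑ (splits Y) (λ (A , B) → Φ h A * Φ a B)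
      Φ-∷ h {y} {Y} v = begin
        Φ h (y ∷ Y) + Φ (convolve a h) Y
          ≈⟨ +-cong (Φ-∷-admissible v h) (≈-sym (Φ-convolve (length Y) a h ≤-refl (valid-tail v))) ⟩
        Φ (h ∘ suc) Y + ∑ (splits Y) (admissible h) + ∑ (splits Y) (inadmissible a h)
          ≈⟨ +-assoc _ _ _ ⟩
        Φ (h ∘ suc) Y + (∑ (splits Y) (admissible h) + ∑ (splits Y) (inadmissible a h))
          ≈⟨ +-congˡ (∑-+ (splits Y) (admissible h) (inadmissible a h)) ⟨
        Φ (h ∘ suc) Y + ∑ (splits Y) (λ p → admissible h p + inadmissible a h p)
          ≈⟨ +-congˡ (∑-cong (splits Y) (admissible+inadmissible h)) ⟩
        Φ (h ∘ suc) Y + ∑ (splits Y) (λ (A , B) → Φ h A * Φ a B) ∎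

-- Peaks and gaps

#nodes≡length : ∀ (t : BinaryPlaneTree) → #nodes t ≡ length (inorder t)
#nodes≡length ∅ = refl
#nodes≡length (node l m r) = begin
  #nodes l +ℕ suc (#nodes r)
      ≡⟨ cong₂ (λ x y → x +ℕ suc y) (#nodes≡length l) (#nodes≡length r) ⟩
  length (inorder l) +ℕ length (m ∷ inorder r)  ≡⟨ length-++ (inorder l) ⟨
  length (inorder l ++ m ∷ inorder r)           ≡⟨ cong length (inorder-node l m r) ⟨
  length (inorder (node l m r))                 ∎
  where open ≡-Reasoning

peaksFrom-suc : ∀ i w → peaksFrom (suc i) w ≡ map suc (peaksFrom i w)
peaksFrom-suc i []          = refl
peaksFrom-suc i (_ ∷ [])    = refl
peaksFrom-suc i (_ ∷ _ ∷ []) = refl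
peaksFrom-suc i (a ∷ b ∷ c ∷ w)
  with ih ← peaksFrom-suc (suc i) (b ∷ c ∷ w)
  with does (a <? b ×-dec c <? b)
... | true  = cong (suc i ∷_) ih
... | false = ih

peaksFrom-+ : ∀ k i w → peaksFrom (k +ℕ i) w ≡ map (k +ℕ_) (peaksFrom i w)
peaksFrom-+ zero    i w = sym (map-id _)
peaksFrom-+ (suc k) i w = trans (peaksFrom-suc (k +ℕ i) w)
  (trans (cong (map suc) (peaksFrom-+ k i w)) (sym (map-∘ (peaksFrom i w))))

peaksFrom-positive : ∀ i w → All (0 <_) (peaksFrom (suc i) w)
peaksFrom-positive i w rewrite peaksFrom-suc i w = Allₚ.map⁺ (All.universal (λ _ → s≤s z≤n) _)

-- A leading maximum has no letter before it and keeps the next letter from being a peak, so it only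
-- shifts indices.
peaksFrom-max∷ : ∀ {m} i {v} → All (_< m) v → peaksFrom i (m ∷ v) ≡ peaksFrom (suc i) v
peaksFrom-max∷ i []           = refl
peaksFrom-max∷ i (_ ∷ [])     = refl
peaksFrom-max∷ {m} i {x ∷ y ∷ v} (x<m ∷ _ ∷ _) rewrite dec-false (m <? x) (<-asym x<m) = refl

-- The neighbours of `m` are not peaks, and neither are they in the two separate words, where they
-- are end letters. As `i` is the index of the second letter, `m` has index `i + length u`, and the
-- second letter after `m` has index two more.
peaksFrom-max : ∀ {m b v} i a u → All (_< m) (a ∷ u) → All (_< m) (b ∷ v) →
  peaksFrom i (a ∷ u ++ m ∷ b ∷ v) ≡
  peaksFrom i (a ∷ u) ++ (i +ℕ length u) ∷ peaksFrom (2 +ℕ i +ℕ length u) (b ∷ v)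
peaksFrom-max {m} {b} {v} i a [] (a<m ∷ []) v<m@(b<m ∷ _)
  rewrite dec-true (a <? m) a<m | dec-true (b <? m) b<m | +ℕ-identityʳ i =
  cong (i ∷_) (peaksFrom-max∷ (suc i) v<m)
peaksFrom-max {m} {b} {v} i a (x ∷ []) (_ ∷ x<m ∷ []) v<m = trans step
  (trans (peaksFrom-max (suc i) x [] (x<m ∷ []) v<m)
    (cong₂ (λ p q → p ∷ peaksFrom q (b ∷ v)) (sym (+ℕ-suc i 0)) (cong (2 +ℕ_) (sym (+ℕ-suc i 0)))))
  where
  step : peaksFrom i (a ∷ x ∷ m ∷ b ∷ v) ≡ peaksFrom (suc i) (x ∷ m ∷ b ∷ v)
  step rewrite dec-false (a <? x ×-dec m <? x) (λ (_ , m<x) → <-asym m<x x<m) = refl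
peaksFrom-max {m} {b} {v} i a (x ∷ y ∷ u) (_ ∷ u<m) v<m
  with ih ← peaksFrom-max (suc i) x (y ∷ u) u<m v<m
  rewrite +ℕ-suc i (suc (length u))
  with does (a <? x ×-dec y <? x)
... | true  = cong (i ∷_) ih
... | false = ih

gaps-shift : ∀ k N r ps → gaps (k +ℕ N) (k +ℕ r) (map (k +ℕ_) ps) ≡ gaps N r ps
gaps-shift k N r []       = cong [_] ([m+n]∸[m+o]≡n∸o k N r)
gaps-shift k N r (p ∷ ps) = cong₂ _∷_ (cong (_∸ 1) ([m+n]∸[m+o]≡n∸o k p r)) (gaps-shift k N p ps)

-- A peak at `suc p` has a word of length `p` before it, and the gap in front of the peak is the
-- last gap of that word.
gaps-++ : ∀ N p r ps rs → gaps N r (ps ++ suc p ∷ rs) ≡ gaps p r ps ++ gaps N (suc p) rs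
gaps-++ N p r []       rs = cong (_∷ gaps N (suc p) rs) (begin
  suc p ∸ r ∸ 1     ≡⟨ ∸-+-assoc (suc p) r 1 ⟩
  suc p ∸ (r +ℕ 1)  ≡⟨ cong (suc p ∸_) (+ℕ-comm r 1) ⟩
  p ∸ r             ∎)
  where open ≡-Reasoning
gaps-++ N p r (q ∷ ps) rs = cong ((q ∸ r ∸ 1) ∷_) (gaps-++ N p q ps rs)

gapWord : List ℕ → List ℕ
gapWord w = gaps (length w) 0 (peaks w)

inorder-positive : ∀ l m r → 0 < length (inorder (node l m r))
inorder-positive l m r
  rewrite sym (#nodes≡length (node l m r)) | +ℕ-suc (#nodes l) (#nodes r) = s≤s z≤n

gapWord-max : ∀ {m} u v → 0 < length u → 0 < length v → All (_< m) u → All (_< m) v →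
  gapWord (u ++ m ∷ v) ≡ gapWord u ++ gapWord v
gapWord-max {m} (a ∷ u) (b ∷ v) _ _ u< v< = begin
  gaps (length (a ∷ u ++ m ∷ b ∷ v)) 0 (peaks (a ∷ u ++ m ∷ b ∷ v))
    ≡⟨ cong₂ (λ N ps → gaps N 0 ps) (length-++ (a ∷ u)) (peaksFrom-max 2 a u u< v<) ⟩
  gaps (L +ℕ suc R) 0 (peaks (a ∷ u) ++ suc L ∷ peaksFrom (2 +ℕ suc L) (b ∷ v))
    ≡⟨ gaps-++ (L +ℕ suc R) L 0 (peaks (a ∷ u)) _ ⟩
  gapWord (a ∷ u) ++ gaps (L +ℕ suc R) (suc L) (peaksFrom (2 +ℕ suc L) (b ∷ v))
    ≡⟨ cong (gapWord (a ∷ u) ++_) (begin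
       gaps (L +ℕ suc R) (suc L) (peaksFrom (2 +ℕ suc L) (b ∷ v))
         ≡⟨ cong₂ (λ N ps → gaps N (suc L) ps) (+ℕ-suc L R)
              (trans (cong (λ k → peaksFrom k (b ∷ v)) (+ℕ-comm 2 (suc L))) (peaksFrom-+ (suc L) 2 (b ∷ v))) ⟩
       gaps (suc L +ℕ R) (suc L) (map (suc L +ℕ_) (peaks (b ∷ v)))
         ≡⟨ cong (λ r → gaps (suc L +ℕ R) r (map (suc L +ℕ_) (peaks (b ∷ v)))) (+ℕ-identityʳ (suc L)) ⟨
       gaps (suc L +ℕ R) (suc L +ℕ 0) (map (suc L +ℕ_) (peaks (b ∷ v)))
         ≡⟨ gaps-shift (suc L) R 0 (peaks (b ∷ v)) ⟩
       gapWord (b ∷ v) ∎) ⟩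
  gapWord (a ∷ u) ++ gapWord (b ∷ v) ∎
  where
  open ≡-Reasoning
  L = length (a ∷ u)
  R = length (b ∷ v)

module GapWeights {c ℓ₁ ℓ₂} (K : HeytingField c ℓ₁ ℓ₂) (κ : ℕ → HeytingField.Carrier K) (X : List ℕ)
    (X! : Unique X) where
  open Summation K
  open TreeSums K
  open Trees X X!

  a : ℕ → Carrier
  a q = - κ (q +ℕ 1)

  open Weights a

  -- A list of gaps is never empty; the default `1#` makes `gapWeight a` agree with `weight κ` on
  -- all lists.
  gapWeight : (ℕ → Carrier) → List ℕ → Carrier
  gapWeight h []       = 1#
  gapWeight h (q ∷ qs) = h q * weight κ qs

  weight-++ : ∀ xs ys → weight κ (xs ++ ys) ≈ weight κ xs * weight κ ys
  weight-++ []       ys = ≈-sym (*-identityˡ _)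
  weight-++ (x ∷ xs) ys = ≈-trans (*-congˡ (weight-++ xs ys)) (≈-sym (*-assoc _ _ _))

  weight≡gapWeight : ∀ qs → weight κ qs ≡ gapWeight a qs
  weight≡gapWeight []      = refl
  weight≡gapWeight (_ ∷ _) = refl

  -- The form `gaps N r ps` guarantees a first entry to carry `h`; after an empty list, `h` would
  -- fall on `ys` instead.
  gapWeight-gaps-++ : ∀ h N r ps ys →
    gapWeight h (gaps N r ps ++ ys) ≈ gapWeight h (gaps N r ps) * gapWeight a ys
  gapWeight-gaps-++ h N r []       ys =
    ≈-trans (*-congˡ (weight-++ [] ys))
        (≈-trans (≈-sym (*-assoc _ _ _)) (*-congˡ (reflexive (weight≡gapWeight ys))))
  gapWeight-gaps-++ h N r (p ∷ ps) ys =
    ≈-trans (*-congˡ (weight-++ (gaps N p ps) ys))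
      (≈-trans (≈-sym (*-assoc _ _ _)) (*-congˡ (reflexive (weight≡gapWeight ys))))

  gapWeight-suc : ∀ h N {ps} → All (0 <_) ps →
    gapWeight h (gaps (suc N) 0 (map suc ps)) ≡ gapWeight (h ∘ suc) (gaps N 0 ps)
  gapWeight-suc h N []                 = refl
  gapWeight-suc h N {suc p ∷ ps} (_ ∷ _) = cong (λ qs → h (suc p) * weight κ qs) (gaps-shift 1 N (suc p) ps)

  -- A root without left child is a leading maximum of the inorder word and lengthens the first gap
  -- by one. A root with two children is an interior maximum, hence a peak, and the list of gaps
  -- breaks there.
  wt≈gapWeight : ∀ h t → Decreasing t → Quasicanonical t → wt h t ≈ gapWeight h (gapWord (inorder t))
  wt≈gapWeight h ∅ _ _ = ≈-sym (*-identityʳ _)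
  wt≈gapWeight h (node ∅ m r) ((_ , r<) , _ , dr) (_ , _ , qr) = begin
    wt (h ∘ suc) r
      ≈⟨ wt≈gapWeight (h ∘ suc) r dr qr ⟩
    gapWeight (h ∘ suc) (gapWord (inorder r))
      ≡⟨ gapWeight-suc h (length (inorder r)) (peaksFrom-positive 1 (inorder r)) ⟨
    gapWeight h (gaps (suc (length (inorder r))) 0 (map suc (peaks (inorder r))))
      ≡⟨ cong (λ ps → gapWeight h (gaps (suc (length (inorder r))) 0 ps))
           (trans (peaksFrom-max∷ 2 (decreasing-bound r dr r<)) (peaksFrom-suc 2 (inorder r))) ⟨
    gapWeight h (gapWord (m ∷ inorder r)) ∎
  -- A root with only a left child would end the inorder word and not be a peak, although `wt`
  -- breaks there; quasicanonicality excludes it.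
  wt≈gapWeight h (node (node _ _ _) m ∅) _ (MaybeAll.just () , _)
  wt≈gapWeight h (node l@(node l₁ a₁ r₁) m r@(node l₂ a₂ r₂)) ((l< , r<) , dl , dr) (_ , ql , qr) = begin
    wt h l * wt a r
      ≈⟨ *-cong (wt≈gapWeight h l dl ql) (wt≈gapWeight a r dr qr) ⟩
    gapWeight h (gapWord (inorder l)) * gapWeight a (gapWord (inorder r))
      ≈⟨ gapWeight-gaps-++ h (length (inorder l)) 0 (peaks (inorder l)) (gapWord (inorder r)) ⟨
    gapWeight h (gapWord (inorder l) ++ gapWord (inorder r))
      ≡⟨ cong (gapWeight h)
          (gapWord-max (inorder l) (inorder r) (inorder-positive l₁ a₁ r₁) (inorder-positive l₂ a₂ r₂)
              (decreasing-bound l dl l<) (decreasing-bound r dr r<)) ⟨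
    gapWeight h (gapWord (inorder l ++ m ∷ inorder r))
      ≡⟨ cong (gapWeight h ∘ gapWord) (inorder-node l m r) ⟨
    gapWeight h (gapWord (inorder (node l m r))) ∎

  weight-𝐪 : ∀ t → Decreasing t → Quasicanonical t → weight κ (𝐪 t) ≈ wt a t
  weight-𝐪 t d q = begin
    weight κ (gaps (#nodes t) 0 (peaks (inorder t)))
      ≡⟨ cong (λ N → weight κ (gaps N 0 (peaks (inorder t)))) (#nodes≡length t) ⟩
    weight κ (gapWord (inorder t))     ≡⟨ weight≡gapWeight (gapWord (inorder t)) ⟩
    gapWeight a (gapWord (inorder t))  ≈⟨ wt≈gapWeight a t d q ⟨
    wt a t                             ∎

-- Set partitions

pattern in∷ B  = inside ∷ᵛ B
pattern out∷ B = outside ∷ᵛ B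

-- A partition of the complement of V is built by removing points from the smallest on.  `Fits V B`
-- says that B is compatible with the blocks making up V, which all contain an earlier point, and
-- `First V B` that a new smallest point may be added to B.
record BlockRelations : Set₁ where
  field
    Compatible Fits First : ∀ {n} → Subset n → Subset n → Set
    compatible? : ∀ {n} (B C : Subset n) → Dec (Compatible B C)
    fits?       : ∀ {n} (V B : Subset n) → Dec (Fits V B)
    first?      : ∀ {n} (V B : Subset n) → Dec (First V B)
    compatible-out-out : ∀ {n} {B C : Subset n} → Compatible (out∷ B) (out∷ C) ⇔ Compatible B C
    compatible-in-out  : ∀ {n} {B C : Subset n} → Compatible (in∷ B) (out∷ C) ⇔ Fits B C
    compatible-in-in   : ∀ {n} {B C : Subset n} → ¬ Compatible (in∷ B) (in∷ C)
    fits-out           : ∀ {n s} {V C : Subset n} → Fits (s ∷ᵛ V) (out∷ C) ⇔ Fits V C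
    fits-out-in        : ∀ {n} {V B : Subset n} → Fits (out∷ V) (in∷ B) ⇔ First V B
    fits-in-in         : ∀ {n} {V B : Subset n} → ¬ Fits (in∷ V) (in∷ B)
    fits-∪             : ∀ {n} {V B C : Subset n} → Fits (V ∪ B) C ⇔ (Fits V C × Fits B C)
    fits-⊥             : ∀ {n} {B : Subset n} → Fits ⊥ B

  IsPartitionOff : ∀ {n} → Subset n → List (Subset n) → Set
  IsPartitionOff V η = All Nonempty η × AllPairs Compatible η × All (Fits V) η ×
                       (∀ i → i ∈ₛ V ⊎ Any (i ∈ₛ_) η)

  isPartitionOff? : ∀ {n} V (η : List (Subset n)) → Dec (IsPartitionOff V η)
  isPartitionOff? V η = All.all? nonempty? η ×-dec AllPairs.allPairs? compatible? η ×-dec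
    All.all? (fits? V) η ×-dec Finₚ.all? λ i → i ∈ₛ? V ⊎-dec Any.any? (i ∈ₛ?_) η

  private
    nonempty-out⁺ : ∀ {n} {B : Subset n} → Nonempty B → Nonempty (out∷ B)
    nonempty-out⁺ (i , i∈) = Fin.suc i , there i∈

    nonempty-out⁻ : ∀ {n} {B : Subset n} → Nonempty (out∷ B) → Nonempty B
    nonempty-out⁻ (Fin.suc i , there i∈) = i , i∈

    any-out⁺ : ∀ {n i} {η : List (Subset n)} → Any (i ∈ₛ_) η → Any (Fin.suc i ∈ₛ_) (map out∷ η)
    any-out⁺ = Anyₚ.map⁺ ∘ Any.map there

    any-out⁻ : ∀ {n i} {η : List (Subset n)} → Any (Fin.suc i ∈ₛ_) (map out∷ η) → Any (i ∈ₛ_) η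
    any-out⁻ = Any.map drop-there ∘ Anyₚ.map⁻

    zero∉out : ∀ {n} {η : List (Subset n)} → ¬ Any (Fin.zero ∈ₛ_) (map out∷ η)
    zero∉out {η = []}    ()
    zero∉out {η = _ ∷ η} (there z) = zero∉out {η = η} z

    to   = Equivalence.to
    from = Equivalence.from

  partitionOff-in : ∀ {n} {V : Subset n} {η} →
    IsPartitionOff (in∷ V) (map out∷ η) ⇔ IsPartitionOff V η
  partitionOff-in {V = V} {η} = mk⇔
    (λ (ne , co , fi , cov) →
      All.map nonempty-out⁻ (Allₚ.map⁻ ne) ,
      AllPairs.map (to compatible-out-out) (AllPairsₚ.map⁻ co) ,
      All.map (to fits-out) (Allₚ.map⁻ fi) ,
      λ i → Sum.map drop-there any-out⁻ (cov (Fin.suc i)))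
    (λ (ne , co , fi , cov) →
      Allₚ.map⁺ (All.map nonempty-out⁺ ne) ,
      AllPairsₚ.map⁺ (AllPairs.map (from compatible-out-out) co) ,
      Allₚ.map⁺ (All.map (from fits-out) fi) ,
      λ { Fin.zero → inj₁ here ; (Fin.suc i) → Sum.map there any-out⁺ (cov i) })

  ¬partitionOff-in : ∀ {n} {V B : Subset n} {η} → ¬ IsPartitionOff (in∷ V) (in∷ B ∷ η)
  ¬partitionOff-in (_ , _ , fi ∷ _ , _) = fits-in-in fi

  -- Opening the block of the smallest point merges `B` into `V`: compatibility of the remaining
  -- blocks with it turns, by `compatible-in-out` and `fits-∪`, into part of fitting `V ∪ B`.
  partitionOff-out : ∀ {n} {V B : Subset n} {η} →
    IsPartitionOff (out∷ V) (in∷ B ∷ map out∷ η) ⇔ (First V B × IsPartitionOff (V ∪ B) η)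
  partitionOff-out {V = V} {B} {η} = mk⇔
    (λ { (_ ∷ ne , co₁ ∷ co , fi₁ ∷ fi , cov) →
      to fits-out-in fi₁ ,
      All.map nonempty-out⁻ (Allₚ.map⁻ ne) ,
      AllPairs.map (to compatible-out-out) (AllPairsₚ.map⁻ co) ,
      All.zipWith (from fits-∪)
          (All.map (to fits-out) (Allₚ.map⁻ fi) , All.map (to compatible-in-out) (Allₚ.map⁻ co₁)) ,
      λ i → covered (cov (Fin.suc i)) })
    (λ (fi₁ , ne , co , fi , cov) →
      (Fin.zero , here) ∷ Allₚ.map⁺ (All.map nonempty-out⁺ ne) ,
      Allₚ.map⁺ (All.map (from compatible-in-out ∘ proj₂ ∘ to fits-∪) fi) ∷
        AllPairsₚ.map⁺ (AllPairs.map (from compatible-out-out) co) ,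
      from fits-out-in fi₁ ∷ Allₚ.map⁺ (All.map (from fits-out ∘ proj₁ ∘ to fits-∪) fi) ,
      λ { Fin.zero → inj₂ (here here) ; (Fin.suc i) → uncovered (cov i) })
    where
    covered : ∀ {i} → Fin.suc i ∈ₛ out∷ V ⊎ Any (Fin.suc i ∈ₛ_) (in∷ B ∷ map out∷ η) →
        i ∈ₛ V ∪ B ⊎ Any (i ∈ₛ_) η
    covered (inj₁ (there i∈V))        = inj₁ (x∈p∪q⁺ (inj₁ i∈V))
    covered (inj₂ (here (there i∈B))) = inj₁ (x∈p∪q⁺ (inj₂ i∈B))
    covered (inj₂ (there i∈η))        = inj₂ (any-out⁻ i∈η)
    uncovered : ∀ {i} → i ∈ₛ V ∪ B ⊎ Any (i ∈ₛ_) η →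
        Fin.suc i ∈ₛ out∷ V ⊎ Any (Fin.suc i ∈ₛ_) (in∷ B ∷ map out∷ η)
    uncovered (inj₂ i∈η) = inj₂ (there (any-out⁺ i∈η))
    uncovered (inj₁ i∈)  with x∈p∪q⁻ V B i∈
    ... | inj₁ i∈V = inj₁ (there i∈V)
    ... | inj₂ i∈B = inj₂ (here (there i∈B))

  ¬partitionOff-out : ∀ {n} {V : Subset n} {η} → ¬ IsPartitionOff (out∷ V) (map out∷ η)
  ¬partitionOff-out {η = η} (_ , _ , _ , cov) with cov Fin.zero
  ... | inj₂ z = zero∉out {η = η} z

  ¬partitionOff-in-in : ∀ {n s} {V : Subset n} {B C η} → ¬ IsPartitionOff (s ∷ᵛ V) (in∷ B ∷ in∷ C ∷ η)
  ¬partitionOff-in-in (_ , (co ∷ _) ∷ _ , _) = compatible-in-in co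

-- Removing the smallest point from a sum over partitions

module PartitionSums {c ℓ₁ ℓ₂} (K : HeytingField c ℓ₁ ℓ₂) where
  open Summation K

  module _ {a} {A : Set a} where

    ∑-sublists-∷ : ∀ (x : A) xs f →
      ∑ (sublists (x ∷ xs)) f ≈ ∑ (sublists xs) (λ α → f (x ∷ α)) + ∑ (sublists xs) f
    ∑-sublists-∷ x xs f = ≈-trans (∑-++ (map (x ∷_) (sublists xs)) (sublists xs) f)
                                  (+-congʳ (∑-map (x ∷_) (sublists xs) f))

    ∑-sublists-++ : ∀ (xs ys : List A) f →
      ∑ (sublists (xs ++ ys)) f ≈ ∑ (sublists xs) λ α → ∑ (sublists ys) λ β → f (α ++ β)
    ∑-sublists-++ []       ys f = ≈-sym (+-identityʳ _)
    ∑-sublists-++ (x ∷ xs) ys f = begin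
      ∑ (sublists (x ∷ xs ++ ys)) f
        ≈⟨ ∑-sublists-∷ x (xs ++ ys) f ⟩
      ∑ (sublists (xs ++ ys)) (λ α → f (x ∷ α)) + ∑ (sublists (xs ++ ys)) f
        ≈⟨ +-cong (∑-sublists-++ xs ys (f ∘ (x ∷_))) (∑-sublists-++ xs ys f) ⟩
      ∑ (sublists xs) (λ α → ∑ (sublists ys) λ β → f (x ∷ α ++ β)) +
      ∑ (sublists xs) (λ α → ∑ (sublists ys) λ β → f (α ++ β))
        ≈⟨ ∑-sublists-∷ x xs _ ⟨
      ∑ (sublists (x ∷ xs)) (λ α → ∑ (sublists ys) λ β → f (α ++ β)) ∎

    ∑-sublists-[] : ∀ (xs : List A) f → (∀ x α → f (x ∷ α) ≈ 0#) → ∑ (sublists xs) f ≈ f []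
    ∑-sublists-[] []       f z = +-identityʳ _
    ∑-sublists-[] (x ∷ xs) f z = ≈-trans (∑-sublists-∷ x xs f)
      (≈-trans (+-cong (∑-zero (sublists xs) λ {α} _ → z x α) (∑-sublists-[] xs f z)) (+-identityˡ _))

    ∑-sublists-[-] : ∀ (xs : List A) f → f [] ≈ 0# → (∀ x y α → f (x ∷ y ∷ α) ≈ 0#) →
      ∑ (sublists xs) f ≈ ∑ xs λ x → f [ x ]
    ∑-sublists-[-] []       f z₀ z₂ = ≈-trans (+-identityʳ _) z₀
    ∑-sublists-[-] (x ∷ xs) f z₀ z₂ = ≈-trans (∑-sublists-∷ x xs f)
      (+-cong (∑-sublists-[] xs (f ∘ (x ∷_)) (z₂ x)) (∑-sublists-[-] xs f z₀ z₂))

  ∑-sublists-map : ∀ {a b} {A : Set a} {B : Set b} (h : A → B) xs f →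
    ∑ (sublists (map h xs)) f ≈ ∑ (sublists xs) (f ∘ map h)
  ∑-sublists-map h []       f = ≈-refl
  ∑-sublists-map h (x ∷ xs) f = ≈-trans (∑-sublists-∷ (h x) (map h xs) f)
    (≈-trans (+-cong (∑-sublists-map h xs _) (∑-sublists-map h xs f)) (≈-sym (∑-sublists-∷ x xs _)))

  ∑-subsets-suc : ∀ n (f : Subset (suc n) → Carrier) →
    ∑ (subsets (suc n)) f ≈ ∑ (subsets n) (f ∘ in∷) + ∑ (subsets n) (f ∘ out∷)
  ∑-subsets-suc n f = ≈-trans (∑-++ (map in∷ (subsets n)) _ f)
    (+-cong (∑-map in∷ (subsets n) f) (∑-map out∷ (subsets n) f))

  ∑-subsets-⊥ : ∀ n (f : Subset n → Carrier) → (∀ B → Nonempty B → f B ≈ 0#) → ∑ (subsets n) f ≈ f ⊥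
  ∑-subsets-⊥ zero    f z = +-identityʳ _
  ∑-subsets-⊥ (suc n) f z = ≈-trans (∑-subsets-suc n f)
    (≈-trans (+-cong (∑-zero (subsets n) λ {B} _ → z (in∷ B) (Fin.zero , here))
                     (∑-subsets-⊥ n (f ∘ out∷) λ B (i , i∈) → z (out∷ B) (Fin.suc i , there i∈)))
             (+-identityˡ _))

  -- Since `subsets` lists the sets with the smallest point first, a set of blocks is a pair: those
  -- containing that point and those avoiding it.
  ∑-sublists-subsets : ∀ n (f : List (Subset (suc n)) → Carrier) →
    ∑ (sublists (subsets (suc n))) f ≈
    ∑ (sublists (subsets n)) λ α → ∑ (sublists (subsets n)) λ β → f (map in∷ α ++ map out∷ β)
  ∑-sublists-subsets n f = ≈-trans (∑-sublists-++ (map in∷ (subsets n)) _ f)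
    (≈-trans (∑-sublists-map in∷ (subsets n) _)
      (∑-cong (sublists (subsets n)) λ α → ∑-sublists-map out∷ (subsets n) _))

  module Blocks (R : BlockRelations) (κ : ℕ → Carrier) where
    open BlockRelations R

    blockProduct : ∀ {n} → List (Subset n) → Carrier
    blockProduct η = ∏ η λ B → κ ∣ B ∣

    partitionSum : ∀ {n} → Subset n → Carrier
    partitionSum {n} V = ∑ (sublists (subsets n)) λ η → when (does (isPartitionOff? V η)) (blockProduct η)

    blockProduct-out : ∀ {n} (η : List (Subset n)) → blockProduct (map out∷ η) ≡ blockProduct η
    blockProduct-out []      = refl
    blockProduct-out (B ∷ η) = cong (κ ∣ B ∣ *_) (blockProduct-out η)

    partitionSum-in : ∀ {n} (V : Subset n) → partitionSum (in∷ V) ≈ partitionSum V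
    partitionSum-in {n} V = begin
      partitionSum (in∷ V)
        ≈⟨ ∑-sublists-subsets n term ⟩
      ∑ (sublists (subsets n)) (λ α → ∑ (sublists (subsets n)) λ β → term (map in∷ α ++ map out∷ β))
        ≈⟨ ∑-sublists-[] (subsets n) _ (λ B α → ∑-zero (sublists (subsets n)) λ {β} _ →
             when-no (isPartitionOff? (in∷ V) (in∷ B ∷ map in∷ α ++ map out∷ β)) ¬partitionOff-in) ⟩
      ∑ (sublists (subsets n)) (λ β → term (map out∷ β))
        ≈⟨ ∑-cong (sublists (subsets n)) (λ β → ≈-trans
             (when-⇔ partitionOff-in (isPartitionOff? (in∷ V) (map out∷ β)) (isPartitionOff? V β))
             (when-cong (does (isPartitionOff? V β)) λ _ → reflexive (blockProduct-out β))) ⟩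
      partitionSum V ∎
      where
      term : List (Subset (suc n)) → Carrier
      term η = when (does (isPartitionOff? (in∷ V) η)) (blockProduct η)

    -- A smallest point outside `V` lies in exactly one block, so only singleton lists of blocks
    -- through it survive, and the sum runs over the rest `B` of that block.
    partitionSum-out : ∀ {n} (V : Subset n) →
      partitionSum (out∷ V) ≈
      ∑ (subsets n) λ B → when (does (first? V B)) (κ (suc ∣ B ∣) * partitionSum (V ∪ B))
    partitionSum-out {n} V = begin
      partitionSum (out∷ V)
        ≈⟨ ∑-sublists-subsets n term ⟩
      ∑ (sublists (subsets n)) (λ α → ∑ (sublists (subsets n)) λ β → term (map in∷ α ++ map out∷ β))
        ≈⟨ ∑-sublists-[-] (subsets n) _
             (∑-zero (sublists (subsets n)) λ {β} _ →
               when-no (isPartitionOff? (out∷ V) (map out∷ β)) (¬partitionOff-out {η = β}))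
             (λ B C α → ∑-zero (sublists (subsets n)) λ {β} _ →
               when-no (isPartitionOff? (out∷ V)
                   (in∷ B ∷ in∷ C ∷ map in∷ α ++ map out∷ β)) ¬partitionOff-in-in) ⟩
      ∑ (subsets n) (λ B → ∑ (sublists (subsets n)) λ β → term (in∷ B ∷ map out∷ β))
        ≈⟨ ∑-cong (subsets n) (λ B → ∑-cong (sublists (subsets n)) (split B)) ⟩
      ∑ (subsets n) (λ B → ∑ (sublists (subsets n)) λ β → when (does (first? V B))
        (κ (suc ∣ B ∣) * when (does (isPartitionOff? (V ∪ B) β)) (blockProduct β)))
        ≈⟨ ∑-cong (subsets n) (λ B → ≈-trans (∑-when (sublists (subsets n)) (does (first? V B)) _)
             (when-cong (does (first? V B)) λ _ → ∑-*ˡ (sublists (subsets n)) (κ (suc ∣ B ∣)) _)) ⟩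
      ∑ (subsets n) (λ B → when (does (first? V B)) (κ (suc ∣ B ∣) * partitionSum (V ∪ B))) ∎
      where
      term : List (Subset (suc n)) → Carrier
      term η = when (does (isPartitionOff? (out∷ V) η)) (blockProduct η)
      split : ∀ B β → term (in∷ B ∷ map out∷ β) ≈
        when (does (first? V B)) (κ (suc ∣ B ∣) * when (does (isPartitionOff? (V ∪ B) β)) (blockProduct β))
      split B β = begin
        term (in∷ B ∷ map out∷ β)
          ≈⟨ when-⇔ partitionOff-out (isPartitionOff? (out∷ V) (in∷ B ∷ map out∷ β))
               (first? V B ×-dec isPartitionOff? (V ∪ B) β) ⟩
        when (does (first? V B ×-dec isPartitionOff? (V ∪ B) β)) (κ (suc ∣ B ∣) * blockProduct (map out∷ β))
          ≡⟨ when-∧ (does (first? V B)) (does (isPartitionOff? (V ∪ B) β)) _ ⟩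
        when (does (first? V B))
            (when (does (isPartitionOff? (V ∪ B) β)) (κ (suc ∣ B ∣) * blockProduct (map out∷ β)))
          ≈⟨ when-cong (does (first? V B)) (λ _ → ≈-trans
               (when-cong (does (isPartitionOff? (V ∪ B) β)) λ _ → *-congˡ (reflexive (blockProduct-out β)))
               (≈-sym (when-*ˡ (does (isPartitionOff? (V ∪ B) β)) (κ (suc ∣ B ∣)) (blockProduct β)))) ⟩
        when (does (first? V B)) (κ (suc ∣ B ∣) * when (does (isPartitionOff? (V ∪ B) β)) (blockProduct β)) ∎

-- Block relations of all partitions and of noncrossing ones

disjoint? : ∀ {n} (B C : Subset n) → Dec (Disjoint B C)
disjoint? B C = ¬? (nonempty? (B ∩ C))

disjoint-out : ∀ {n} s {V C : Subset n} → Disjoint (s ∷ᵛ V) (out∷ C) ⇔ Disjoint V C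
disjoint-out s {V} {C} = mk⇔
  (λ d (i , i∈) → let i∈V , i∈C = x∈p∩q⁻ V C i∈ in d (Fin.suc i , x∈p∩q⁺ {p = s ∷ᵛ V} (there i∈V , there i∈C)))
  (λ d (i , i∈) → shift d i (x∈p∩q⁻ (s ∷ᵛ V) (out∷ C) i∈))
  where
  shift : Disjoint V C → ∀ i → ¬ (i ∈ₛ s ∷ᵛ V × i ∈ₛ out∷ C)
  shift d (Fin.suc i) (there i∈V , there i∈C) = d (i , x∈p∩q⁺ (i∈V , i∈C))

disjoint-out-in : ∀ {n} {V B : Subset n} → Disjoint (out∷ V) (in∷ B) ⇔ Disjoint V B
disjoint-out-in {V = V} {B} = mk⇔
  (λ d (i , i∈) → let i∈V , i∈B = x∈p∩q⁻ V B i∈ in d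
      (Fin.suc i , x∈p∩q⁺ {p = out∷ V} {q = in∷ B} (there i∈V , there i∈B)))
  (λ { d (Fin.suc i , there i∈) → d (i , i∈) })

disjoint-in-in : ∀ {n} {V B : Subset n} → ¬ Disjoint (in∷ V) (in∷ B)
disjoint-in-in d = d (Fin.zero , here)

disjoint-∪ : ∀ {n} {V B C : Subset n} → Disjoint (V ∪ B) C ⇔ (Disjoint V C × Disjoint B C)
disjoint-∪ {V = V} {B} {C} = mk⇔
  (λ d → (λ (i , i∈) → let i∈V , i∈C = x∈p∩q⁻ V C i∈ in d (i , x∈p∩q⁺ (x∈p∪q⁺ (inj₁ i∈V) , i∈C))) ,
         (λ (i , i∈) → let i∈B , i∈C = x∈p∩q⁻ B C i∈ in d (i , x∈p∩q⁺ (x∈p∪q⁺ (inj₂ i∈B) , i∈C))))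
  (λ (dV , dB) (i , i∈) → let i∈∪ , i∈C = x∈p∩q⁻ (V ∪ B) C i∈ in
    [ (λ i∈V → dV (i , x∈p∩q⁺ (i∈V , i∈C))) , (λ i∈B → dB (i , x∈p∩q⁺ (i∈B , i∈C))) ]′ (x∈p∪q⁻ V B i∈∪))

disjoint-⊥ : ∀ {n} {B : Subset n} → Disjoint ⊥ B
disjoint-⊥ {B = B} (i , i∈) = ∉⊥ (proj₁ (x∈p∩q⁻ ⊥ B i∈))

allPartitions : BlockRelations
allPartitions = record
  { Compatible = Disjoint
  ; Fits = Disjoint
  ; First = Disjoint
  ; compatible? = disjoint?
  ; fits? = disjoint?
  ; first? = disjoint?
  ; compatible-out-out = disjoint-out outside
  ; compatible-in-out = disjoint-out inside
  ; compatible-in-in = disjoint-in-in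
  ; fits-out = λ {_} {s} → disjoint-out s
  ; fits-out-in = disjoint-out-in
  ; fits-in-in = disjoint-in-in
  ; fits-∪ = disjoint-∪
  ; fits-⊥ = disjoint-⊥
  }

-- Each block inside `V` also has a point before all those under consideration; together with
-- `i < v < j` that earlier point makes a crossing.
Straddles : ∀ {n} → Subset n → Subset n → Set
Straddles V C = ∃[ i ] ∃[ v ] ∃[ j ] (i ∈ₛ C × v ∈ₛ V × j ∈ₛ C) × (i <ᶠ v × v <ᶠ j)

straddles? : ∀ {n} (V C : Subset n) → Dec (Straddles V C)
straddles? V C = Finₚ.any? λ i → Finₚ.any? λ v → Finₚ.any? λ j →
  (i ∈ₛ? C ×-dec v ∈ₛ? V ×-dec j ∈ₛ? C) ×-dec (i Finₚ.<? v ×-dec v Finₚ.<? j)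

-- Once the smallest point joins `B`, a point of `V` below some point of `B` would be straddled, so
-- `B` must end before `V` begins.
Precedes : ∀ {n} → Subset n → Subset n → Set
Precedes V B = ∀ v b → v ∈ₛ V → b ∈ₛ B → b <ᶠ v

precedes? : ∀ {n} (V B : Subset n) → Dec (Precedes V B)
precedes? V B = Finₚ.all? λ v → Finₚ.all? λ b → v ∈ₛ? V →-dec (b ∈ₛ? B →-dec b Finₚ.<? v)

straddles-out : ∀ {n s} {V C : Subset n} → Straddles (s ∷ᵛ V) (out∷ C) ⇔ Straddles V C
straddles-out = mk⇔
  (λ { (_ , _ , _ , (there i∈ , there v∈ , there j∈) , (s≤s i<v , s≤s v<j)) →
         _ , _ , _ , (i∈ , v∈ , j∈) , (i<v , v<j) })
  (λ (_ , _ , _ , (i∈ , v∈ , j∈) , (i<v , v<j)) →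
         _ , _ , _ , (there i∈ , there v∈ , there j∈) , (s≤s i<v , s≤s v<j))

crossing-out-out : ∀ {n} {B C : Subset n} → Crossing (out∷ B) (out∷ C) ⇔ Crossing B C
crossing-out-out = mk⇔
  (λ { (_ , _ , _ , _ , ((there i∈ , there j∈) , (there i′∈ , there j′∈)) , p) →
         _ , _ , _ , _ , ((i∈ , j∈) , (i′∈ , j′∈)) , Sum.map lower lower p })
  (λ { (_ , _ , _ , _ , ((i∈ , j∈) , (i′∈ , j′∈)) , p) →
         _ , _ , _ , _ , ((there i∈ , there j∈) , (there i′∈ , there j′∈)) , Sum.map raise raise p })
  where
  lower : ∀ {n} {p q r s t u : Fin n} →
    Fin.suc p <ᶠ Fin.suc q × Fin.suc r <ᶠ Fin.suc s × Fin.suc t <ᶠ Fin.suc u → p <ᶠ q × r <ᶠ s × t <ᶠ u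
  lower (s≤s p , s≤s q , s≤s r) = p , q , r
  raise : ∀ {n} {p q r s t u : Fin n} →
    p <ᶠ q × r <ᶠ s × t <ᶠ u → Fin.suc p <ᶠ Fin.suc q × Fin.suc r <ᶠ Fin.suc s × Fin.suc t <ᶠ Fin.suc u
  raise (p , q , r) = s≤s p , s≤s q , s≤s r

crossing-in-out : ∀ {n} {B C : Subset n} → Crossing (in∷ B) (out∷ C) ⇔ Straddles B C
crossing-in-out = mk⇔
  (λ { (_ , _ , _ , _ , ((_ , there j∈) , (there i′∈ , there j′∈)) , inj₁ (_ , s≤s i′<j , s≤s j<j′)) →
         _ , _ , _ , (i′∈ , j∈ , j′∈) , (i′<j , j<j′)
     ; (_ , _ , _ , _ , ((there i∈ , there j∈) ,
         (there i′∈ , there j′∈)) , inj₂ (s≤s i′<i , s≤s j<i′ , s≤s j′<j)) →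
         _ , _ , _ , (j′∈ , j∈ , i′∈) , (j′<j , j<i′) })
  (λ (i , v , j , (i∈ , v∈ , j∈) , (i<v , v<j)) →
    Fin.zero , Fin.suc v , Fin.suc i , Fin.suc j , ((here , there v∈) , (there i∈ , there j∈)) ,
    inj₁ (s≤s z≤n , s≤s i<v , s≤s v<j))

noncrossingPartitions : BlockRelations
noncrossingPartitions = record
  { Compatible = λ B C → Disjoint B C × ¬ Crossing B C
  ; Fits = λ V B → Disjoint V B × ¬ Straddles V B
  ; First = Precedes
  ; compatible? = λ B C → disjoint? B C ×-dec ¬? (crossing? B C)
  ; fits? = λ V B → disjoint? V B ×-dec ¬? (straddles? V B)
  ; first? = precedes?
  ; compatible-out-out = mk⇔
      (λ (d , ¬c) → to (disjoint-out outside) d , ¬c ∘ from crossing-out-out)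
      (λ (d , ¬c) → from (disjoint-out outside) d , ¬c ∘ to crossing-out-out)
  ; compatible-in-out = mk⇔
      (λ (d , ¬c) → to (disjoint-out inside) d , ¬c ∘ from crossing-in-out)
      (λ (d , ¬c) → from (disjoint-out inside) d , ¬c ∘ to crossing-in-out)
  ; compatible-in-in = disjoint-in-in ∘ proj₁
  ; fits-out = λ {_} {s} → mk⇔
      (λ (d , ¬s) → to (disjoint-out s) d , ¬s ∘ from straddles-out)
      (λ (d , ¬s) → from (disjoint-out s) d , ¬s ∘ to straddles-out)
  ; fits-out-in = mk⇔ precedes fits
  ; fits-in-in = disjoint-in-in ∘ proj₁
  ; fits-∪ = mk⇔
      (λ (d , ¬s) → (proj₁ (to disjoint-∪ d) , ¬s ∘ straddles-∪ inj₁) ,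
                    (proj₂ (to disjoint-∪ d) , ¬s ∘ straddles-∪ inj₂))
      (λ ((dV , ¬sV) , (dB , ¬sB)) → from disjoint-∪ (dV , dB) ,
        λ { (_ , _ , _ , (i∈ , v∈ , j∈) , lt) →
            [ (λ v∈ → ¬sV (_ , _ , _ , (i∈ , v∈ , j∈) , lt)) ,
              (λ v∈ → ¬sB (_ , _ , _ , (i∈ , v∈ , j∈) , lt)) ]′ (x∈p∪q⁻ _ _ v∈) })
  ; fits-⊥ = disjoint-⊥ , λ (_ , _ , _ , (_ , v∈ , _) , _) → ∉⊥ v∈
  }
  where
  to   = Equivalence.to
  from = Equivalence.from

  precedes : ∀ {n} {V B : Subset n} → Disjoint (out∷ V) (in∷ B) × ¬ Straddles (out∷ V) (in∷ B) → Precedes V B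
  precedes {V = V} {B} (d , ¬s) v b v∈ b∈ with ℕₚ.<-cmp (Fin.toℕ b) (Fin.toℕ v)
  ... | tri< b<v _ _ = b<v
  ... | tri≈ _ b≡v _ = ⊥-elim
      (to disjoint-out-in d (v , x∈p∩q⁺ (v∈ , subst (_∈ₛ B) (Finₚ.toℕ-injective b≡v) b∈)))
  ... | tri> _ _ v<b = ⊥-elim
      (¬s (Fin.zero , Fin.suc v , Fin.suc b , (here , there v∈ , there b∈) , (s≤s z≤n , s≤s v<b)))

  fits : ∀ {n} {V B : Subset n} → Precedes V B → Disjoint (out∷ V) (in∷ B) × ¬ Straddles (out∷ V) (in∷ B)
  fits {V = V} {B} p = from disjoint-out-in (λ (i , i∈) → let i∈V , i∈B = x∈p∩q⁻ V B i∈ in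
                 <-irrefl refl (p i i i∈V i∈B)) ,
    λ { (_ , Fin.suc v , Fin.suc j , (_ , there v∈ , there j∈) , (_ , s≤s v<j)) → <-asym v<j (p v j v∈ j∈) }

  straddles-∪ : ∀ {n} {V B W C : Subset n} → (∀ {x} → x ∈ₛ W → x ∈ₛ V ⊎ x ∈ₛ B) → Straddles W C →
      Straddles (V ∪ B) C
  straddles-∪ f (_ , _ , _ , (i∈ , v∈ , j∈) , lt) = _ , _ , _ , (i∈ , x∈p∪q⁺ (f v∈) , j∈) , lt

isPartition⇔ : ∀ {n} {η : List (Subset n)} → IsPartition η ⇔ BlockRelations.IsPartitionOff allPartitions ⊥ η
isPartition⇔ = mk⇔
  (λ (ne , dis , cov) → ne , dis , All.universal (λ _ → disjoint-⊥) _ , inj₂ ∘ cov)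
  (λ (ne , dis , _ , cov) → ne , dis , λ i → [ ⊥-elim ∘ ∉⊥ , id ]′ (cov i))

noncrossing⇔ : ∀ {n} {η : List (Subset n)} →
  (IsPartition η × Noncrossing η) ⇔ BlockRelations.IsPartitionOff noncrossingPartitions ⊥ η
noncrossing⇔ = mk⇔
  (λ ((ne , dis , cov) , nc) → ne , AllPairs.zip (dis , nc) ,
    All.universal (λ _ → BlockRelations.fits-⊥ noncrossingPartitions) _ , inj₂ ∘ cov)
  (λ (ne , co , _ , cov) →
      (ne , AllPairs.map proj₁ co , λ i → [ ⊥-elim ∘ ∉⊥ , id ]′ (cov i)) , AllPairs.map proj₂ co)

precedes-out : ∀ {n s} {V B : Subset n} → Precedes (out∷ V) (s ∷ᵛ B) ⇔ Precedes V B
precedes-out = mk⇔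
  (λ p v b v∈ b∈ → ℕ.s≤s⁻¹ (p (Fin.suc v) (Fin.suc b) (there v∈) (there b∈)))
  (λ { p (Fin.suc v) Fin.zero    v∈ b∈ → s≤s z≤n
     ; p (Fin.suc v) (Fin.suc b) (there v∈) (there b∈) → s≤s (p v b v∈ b∈) })

¬precedes-in : ∀ {n s} {V B : Subset n} → Nonempty B → ¬ Precedes (in∷ V) (s ∷ᵛ B)
¬precedes-in (b , b∈) p with () ← p Fin.zero (Fin.suc b) here (there b∈)

precedes-⊥ : ∀ {n} {V : Subset n} → Precedes V ⊥
precedes-⊥ _ _ _ b∈ = ⊥-elim (∉⊥ b∈)

nonempty⇒∣B∣≡suc : ∀ {n} {B : Subset n} → Nonempty B → ∃[ k ] ∣ B ∣ ≡ suc k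
nonempty⇒∣B∣≡suc {B = in∷ B}  _ = ∣ B ∣ , refl
nonempty⇒∣B∣≡suc {B = out∷ B} (Fin.suc i , there i∈) = nonempty⇒∣B∣≡suc (i , i∈)

-- Recursions for the free and the classical moments

module Counting {c ℓ₁ ℓ₂} (K : HeytingField c ℓ₁ ℓ₂) where
  open Summation K
  open TreeSums K using (convolve)
  open PartitionSums K

  δ : ℕ → Carrier
  δ zero    = 1#
  δ (suc _) = 0#

  module Free (κ : ℕ → Carrier) where
    open Blocks noncrossingPartitions κ

    -- The adjoint of Voiculescu's canonical operator with free cumulants κ.
    step : (ℕ → Carrier) → ℕ → Carrier
    step h k = h (suc k) + convolve (κ ∘ suc) h k

    steps : ℕ → (ℕ → Carrier) → ℕ → Carrier
    steps zero    h = h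
    steps (suc n) h = steps n (step h)

    -- The union `W` and the size of `B` determine the pair: `B` is an initial piece of `W` and `V`
    -- the rest. Summing over the possible sizes gives a convolution at `∣ W ∣`.
    ∑-precedes : ∀ n b h (G : Subset n → Carrier) →
      ∑ (subsets n) (λ V → ∑ (subsets n) λ B → when (does (precedes? V B)) (b ∣ B ∣ * h ∣ V ∣ * G (V ∪ B))) ≈
      ∑ (subsets n) (λ W → convolve b h ∣ W ∣ * G W)
    ∑-precedes zero b h G = ≈-trans (+-identityʳ _) ≈-refl
    ∑-precedes (suc n) b h G = begin
      ∑ (subsets (suc n)) (λ V → ∑ (subsets (suc n)) (F V))
        ≈⟨ ∑-subsets-suc n _ ⟩
      ∑ (subsets n) (λ V → ∑ (subsets (suc n)) (F (in∷ V))) +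
          ∑ (subsets n) (λ V → ∑ (subsets (suc n)) (F (out∷ V)))
        ≈⟨ +-cong (∑-cong (subsets n) onlyEmpty)
             (≈-trans (∑-cong (subsets n) λ V → ∑-subsets-suc n (F (out∷ V))) (∑-+ (subsets n) _ _)) ⟩
      ∑ (subsets n) (λ V → b 0 * h (suc ∣ V ∣) * G (in∷ V)) +
      (∑ (subsets n) (λ V → ∑ (subsets n) (F (out∷ V) ∘ in∷)) +
          ∑ (subsets n) (λ V → ∑ (subsets n) (F (out∷ V) ∘ out∷)))
        ≈⟨ +-congˡ (+-cong (smaller inside) (smaller outside)) ⟩
      ∑ (subsets n) (λ V → b 0 * h (suc ∣ V ∣) * G (in∷ V)) +
      (∑ (subsets n) (λ V → ∑ (subsets n) λ B → when (does (precedes? V B))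
          ((b ∘ suc) ∣ B ∣ * h ∣ V ∣ * (G ∘ in∷) (V ∪ B))) +
       ∑ (subsets n) (λ V → ∑ (subsets n) λ B → when (does (precedes? V B))
           (b ∣ B ∣ * h ∣ V ∣ * (G ∘ out∷) (V ∪ B))))
        ≈⟨ +-congˡ (+-cong (∑-precedes n (b ∘ suc) h (G ∘ in∷)) (∑-precedes n b h (G ∘ out∷))) ⟩
      ∑ (subsets n) (λ V → b 0 * h (suc ∣ V ∣) * G (in∷ V)) +
      (∑ (subsets n) (λ W → convolve (b ∘ suc) h ∣ W ∣ * G (in∷ W)) +
          ∑ (subsets n) (λ W → convolve b h ∣ W ∣ * G (out∷ W)))
        ≈⟨ +-assoc _ _ _ ⟨
      ∑ (subsets n) (λ V → b 0 * h (suc ∣ V ∣) * G (in∷ V)) +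
      ∑ (subsets n) (λ W → convolve (b ∘ suc) h ∣ W ∣ * G (in∷ W)) +
          ∑ (subsets n) (λ W → convolve b h ∣ W ∣ * G (out∷ W))
        ≈⟨ +-congʳ (≈-trans (≈-sym (∑-+ (subsets n) _ _)) (∑-cong (subsets n) λ W → ≈-sym (distribʳ _ _ _))) ⟩
      ∑ (subsets n) (λ W → convolve b h (suc ∣ W ∣) * G (in∷ W)) +
          ∑ (subsets n) (λ W → convolve b h ∣ W ∣ * G (out∷ W))
        ≈⟨ ∑-subsets-suc n _ ⟨
      ∑ (subsets (suc n)) (λ W → convolve b h ∣ W ∣ * G W) ∎
      where
      F : Subset (suc n) → Subset (suc n) → Carrier
      F V B = when (does (precedes? V B)) (b ∣ B ∣ * h ∣ V ∣ * G (V ∪ B))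

      -- Nothing lies before the smallest point, so once `V` contains it `B` must be empty; this is
      -- the term of size 0 in the convolution.
      onlyEmpty : ∀ V → ∑ (subsets (suc n)) (F (in∷ V)) ≈ b 0 * h (suc ∣ V ∣) * G (in∷ V)
      onlyEmpty V = begin
        ∑ (subsets (suc n)) (F (in∷ V))
          ≈⟨ ∑-subsets-suc n (F (in∷ V)) ⟩
        ∑ (subsets n) (F (in∷ V) ∘ in∷) + ∑ (subsets n) (F (in∷ V) ∘ out∷)
          ≈⟨ +-cong (∑-zero (subsets n) λ _ → ≈-refl)
               (∑-subsets-⊥ n _ λ B ne → when-no (precedes? (in∷ V) (out∷ B)) (¬precedes-in ne)) ⟩
        0# + F (in∷ V) ⊥
          ≈⟨ +-identityˡ _ ⟩
        F (in∷ V) ⊥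
          ≈⟨ when-yes (precedes? (in∷ V) ⊥) precedes-⊥ ⟩
        b ∣ ⊥ {n} ∣ * h (suc ∣ V ∣) * G (in∷ (V ∪ ⊥))
          ≡⟨ cong₂ (λ k W → b k * h (suc ∣ V ∣) * G (in∷ W)) (∣⊥∣≡0 n) (∪-identityʳ V) ⟩
        b 0 * h (suc ∣ V ∣) * G (in∷ V) ∎

      smaller : ∀ s → ∑ (subsets n) (λ V → ∑ (subsets n) λ B → F (out∷ V) (s ∷ᵛ B)) ≈
        ∑ (subsets n) (λ V → ∑ (subsets n) λ B → when (does (precedes? V B))
            (b ∣ s ∷ᵛ B ∣ * h ∣ V ∣ * G (s ∷ᵛ V ∪ B)))
      smaller s = ∑-cong (subsets n) λ V → ∑-cong (subsets n) λ B →
        when-⇔ precedes-out (precedes? (out∷ V) (s ∷ᵛ B)) (precedes? V B)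

    -- `V` is the set of points promised to blocks opened earlier, and `h` sees only their number.
    -- The next point either belongs to `V`, which shifts `h`, or opens a block, which convolves `h`
    -- with the cumulants; together these make one `step`.
    ∑-partitionSum : ∀ n h → ∑ (subsets n) (λ V → h ∣ V ∣ * partitionSum V) ≈ steps n h 0
    ∑-partitionSum zero h = begin
      h 0 * (0# + (1# + 0#)) + 0#  ≈⟨ +-identityʳ _ ⟩
      h 0 * (0# + (1# + 0#))       ≈⟨ *-congˡ (≈-trans (+-identityˡ _) (+-identityʳ _)) ⟩
      h 0 * 1#                     ≈⟨ *-identityʳ _ ⟩
      h 0                          ∎
    ∑-partitionSum (suc n) h = begin
      ∑ (subsets (suc n)) (λ V → h ∣ V ∣ * partitionSum V)
        ≈⟨ ∑-subsets-suc n _ ⟩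
      ∑ (subsets n) (λ V → h (suc ∣ V ∣) * partitionSum (in∷ V)) +
          ∑ (subsets n) (λ V → h ∣ V ∣ * partitionSum (out∷ V))
        ≈⟨ +-cong (∑-cong (subsets n) λ V → *-congˡ (partitionSum-in V)) (∑-cong (subsets n) opened) ⟩
      ∑ (subsets n) (λ V → h (suc ∣ V ∣) * partitionSum V) +
      ∑ (subsets n) (λ V → ∑ (subsets n) λ B → when (does (precedes? V B))
          (κ (suc ∣ B ∣) * h ∣ V ∣ * partitionSum (V ∪ B)))
        ≈⟨ +-congˡ (∑-precedes n (κ ∘ suc) h partitionSum) ⟩
      ∑ (subsets n) (λ V → h (suc ∣ V ∣) * partitionSum V) +
          ∑ (subsets n) (λ V → convolve (κ ∘ suc) h ∣ V ∣ * partitionSum V)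
        ≈⟨ ∑-+ (subsets n) _ _ ⟨
      ∑ (subsets n) (λ V → h (suc ∣ V ∣) * partitionSum V + convolve (κ ∘ suc) h ∣ V ∣ * partitionSum V)
        ≈⟨ ∑-cong (subsets n) (λ V → distribʳ _ _ _) ⟨
      ∑ (subsets n) (λ V → step h ∣ V ∣ * partitionSum V)
        ≈⟨ ∑-partitionSum n (step h) ⟩
      steps n (step h) 0 ∎
      where
      opened : ∀ V → h ∣ V ∣ * partitionSum (out∷ V) ≈
        ∑ (subsets n) λ B → when (does (precedes? V B)) (κ (suc ∣ B ∣) * h ∣ V ∣ * partitionSum (V ∪ B))
      opened V = begin
        h ∣ V ∣ * partitionSum (out∷ V)
          ≈⟨ *-congˡ (partitionSum-out V) ⟩
        h ∣ V ∣ * ∑ (subsets n) (λ B → when (does (precedes? V B)) (κ (suc ∣ B ∣) * partitionSum (V ∪ B)))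
          ≈⟨ ∑-*ˡ (subsets n) (h ∣ V ∣) _ ⟨
        ∑ (subsets n) (λ B → h ∣ V ∣ * when (does (precedes? V B)) (κ (suc ∣ B ∣) * partitionSum (V ∪ B)))
          ≈⟨ ∑-cong (subsets n) (λ B → ≈-trans (when-*ˡ (does (precedes? V B)) (h ∣ V ∣) _)
               (when-cong (does (precedes? V B)) λ _ → ≈-trans (*-leftComm _ _ _) (≈-sym (*-assoc _ _ _)))) ⟩
        ∑ (subsets n) (λ B → when (does (precedes? V B)) (κ (suc ∣ B ∣) * h ∣ V ∣ * partitionSum (V ∪ B))) ∎

    momentFromFree≈steps : ∀ n → momentFromFree κ n ≈ steps n δ 0
    momentFromFree≈steps n = begin
      ∑ (NC n) blockProduct
        ≈⟨ ∑-filter noncrossing? (Π n) blockProduct ⟩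
      ∑ (Π n) (λ η → when (does (noncrossing? η)) (blockProduct η))
        ≈⟨ ∑-filter isPartition? (sublists (subsets n)) _ ⟩
      ∑ (sublists (subsets n))
          (λ η → when (does (isPartition? η)) (when (does (noncrossing? η)) (blockProduct η)))
        ≈⟨ ∑-cong (sublists (subsets n)) (λ η → ≈-trans
             (reflexive (sym (when-∧ (does (isPartition? η)) (does (noncrossing? η)) _)))
             (when-⇔ noncrossing⇔ (isPartition? η ×-dec noncrossing? η)
               (BlockRelations.isPartitionOff? noncrossingPartitions ⊥ η))) ⟩
      partitionSum (⊥ {n})
        ≈⟨ *-identityˡ _ ⟨
      1# * partitionSum (⊥ {n})
        ≡⟨ cong (λ k → δ k * partitionSum (⊥ {n})) (∣⊥∣≡0 n) ⟨
      δ ∣ ⊥ {n} ∣ * partitionSum (⊥ {n})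
        -- `δ` vanishes at the size of a nonempty set, so starting from `δ` means that no point is
        -- promised in advance.
        ≈⟨ ∑-subsets-⊥ n _ (λ B ne → ≈-trans
             (*-congʳ (reflexive (cong δ (proj₂ (nonempty⇒∣B∣≡suc ne))))) (zeroˡ _)) ⟨
      ∑ (subsets n) (λ V → δ ∣ V ∣ * partitionSum V)
        ≈⟨ ∑-partitionSum n δ ⟩
      steps n δ 0 ∎

  module Classical (c : ℕ → Carrier) where
    open Blocks allPartitions c

    moment : ℕ → Carrier
    moment n = partitionSum (⊥ {n})

    momentFromClassical≈moment : ∀ n → momentFromClassical c n ≈ moment n
    momentFromClassical≈moment n = ≈-trans (∑-filter isPartition? (sublists (subsets n)) blockProduct)
      (∑-cong (sublists (subsets n)) λ η →
        when-⇔ isPartition⇔ (isPartition? η) (BlockRelations.isPartitionOff? allPartitions ⊥ η))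

    -- A set disjoint from `V` splits the free points into itself and what remains. Any list of the
    -- right length may index these splits, in particular the label list of a tree.
    ∑-disjoint : ∀ {a} {A : Set a} {n} (V : Subset n) (ys : List A) → length ys ≡ ∣ ∁ V ∣ →
        ∀ (g : ℕ → ℕ → Carrier) →
      ∑ (subsets n) (λ B → when (does (disjoint? V B)) (g ∣ B ∣ ∣ ∁ (V ∪ B) ∣)) ≈
      ∑ (splits ys) (λ (as , bs) → g (length as) (length bs))
    ∑-disjoint {n = zero}  []ᵛ []       refl g = ≈-refl
    ∑-disjoint {n = suc n} (in∷ V) ys eq g = begin
      ∑ (subsets (suc n)) (F (in∷ V))
        ≈⟨ ∑-subsets-suc n (F (in∷ V)) ⟩
      ∑ (subsets n) (F (in∷ V) ∘ in∷) + ∑ (subsets n) (F (in∷ V) ∘ out∷)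
        ≈⟨ +-cong (∑-zero (subsets n) λ _ → ≈-refl)
             (∑-cong (subsets n) λ B → when-⇔ (disjoint-out inside) (disjoint? (in∷ V) (out∷ B))
                 (disjoint? V B)) ⟩
      0# + ∑ (subsets n) (λ B → when (does (disjoint? V B)) (g ∣ B ∣ ∣ ∁ (V ∪ B) ∣))
        ≈⟨ +-identityˡ _ ⟩
      ∑ (subsets n) (λ B → when (does (disjoint? V B)) (g ∣ B ∣ ∣ ∁ (V ∪ B) ∣))
        ≈⟨ ∑-disjoint V ys eq g ⟩
      ∑ (splits ys) (λ (as , bs) → g (length as) (length bs)) ∎
      where
      F : Subset (suc n) → Subset (suc n) → Carrier
      F V B = when (does (disjoint? V B)) (g ∣ B ∣ ∣ ∁ (V ∪ B) ∣)
    ∑-disjoint {n = suc n} (out∷ V) (y ∷ ys) eq g = begin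
      ∑ (subsets (suc n)) (F (out∷ V))
        ≈⟨ ∑-subsets-suc n (F (out∷ V)) ⟩
      ∑ (subsets n) (F (out∷ V) ∘ in∷) + ∑ (subsets n) (F (out∷ V) ∘ out∷)
        ≈⟨ +-cong (∑-cong (subsets n) λ B → when-⇔ disjoint-out-in (disjoint? (out∷ V) (in∷ B)) (disjoint? V B))
                  (∑-cong (subsets n) λ B → when-⇔ (disjoint-out outside) (disjoint? (out∷ V) (out∷ B))
                      (disjoint? V B)) ⟩
      ∑ (subsets n) (λ B → when (does (disjoint? V B)) (g (suc ∣ B ∣) ∣ ∁ (V ∪ B) ∣)) +
      ∑ (subsets n) (λ B → when (does (disjoint? V B)) (g ∣ B ∣ (suc ∣ ∁ (V ∪ B) ∣)))
        ≈⟨ +-cong (∑-disjoint V ys (ℕₚ.suc-injective eq) (λ p q → g (suc p) q))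
                  (∑-disjoint V ys (ℕₚ.suc-injective eq) (λ p q → g p (suc q))) ⟩
      ∑ (splits ys) (λ (as , bs) → g (suc (length as)) (length bs)) +
      ∑ (splits ys) (λ (as , bs) → g (length as) (suc (length bs)))
        ≈⟨ ∑-splits-∷ y ys _ ⟨
      ∑ (splits (y ∷ ys)) (λ (as , bs) → g (length as) (length bs)) ∎
      where
      F : Subset (suc n) → Subset (suc n) → Carrier
      F V B = when (does (disjoint? V B)) (g ∣ B ∣ ∣ ∁ (V ∪ B) ∣)

    ∣∁⊥∣ : ∀ n → ∣ ∁ (⊥ {n}) ∣ ≡ n
    ∣∁⊥∣ n = trans (∣∁p∣≡n∸∣p∣ (⊥ {n})) (cong (n ℕ.∸_) (∣⊥∣≡0 n))

    private
      SizeOnly : ℕ → Set _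
      SizeOnly n = ∀ (V : Subset n) → partitionSum V ≈ moment ∣ ∁ V ∣

      opened : ∀ {n} → SizeOnly n → ∀ (V : Subset n) {a} {A : Set a} (ys : List A) → length ys ≡ ∣ ∁ V ∣ →
        partitionSum (out∷ V) ≈ ∑ (splits ys) λ (as , bs) → c (suc (length as)) * moment (length bs)
      opened {n} u V ys eq = ≈-trans (partitionSum-out V)
        (≈-trans (∑-cong (subsets n) λ B → when-cong (does (disjoint? V B)) λ _ → *-congˡ (u (V ∪ B)))
                 (∑-disjoint V ys eq λ p q → c (suc p) * moment q))

      -- The sums for `V` and for the empty set on `∣ ∁ V ∣` points unfold to the same recursion;
      -- `replicate k tt` only counts the free points. The bound `m` is there for termination, as
      -- the second unfolding moves from `n` to `∣ ∁ V ∣`.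
      sizeOnly : ∀ m n → n ≤ m → SizeOnly n
      sizeOnly m       zero    _       []ᵛ      = ≈-refl
      sizeOnly (suc m) (suc n) (s≤s p) (in∷ V)  = ≈-trans (partitionSum-in V) (sizeOnly m n p V)
      sizeOnly (suc m) (suc n) (s≤s p) (out∷ V) = ≈-trans
        (opened (sizeOnly m n p) V (replicate k tt) (length-replicate k))
        (≈-sym (opened (sizeOnly m k (≤-trans (∣p∣≤n (∁ V)) p)) (⊥ {k}) (replicate k tt)
          (trans (length-replicate k) (sym (∣∁⊥∣ k)))))
        where k = ∣ ∁ V ∣

    -- The block of the smallest point takes the points in `as`, and the other blocks partition
    -- `bs`; these are the coefficients of M′ = C′ · M.
    moment-suc : ∀ {a} {A : Set a} (ys : List A) →
      moment (suc (length ys)) ≈ ∑ (splits ys) λ (as , bs) → c (suc (length as)) * moment (length bs)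
    moment-suc ys = opened (sizeOnly (length ys) (length ys) ≤-refl) (⊥ {length ys}) ys (sym (∣∁⊥∣ (length ys)))

    moment-0 : moment 0 ≈ 1#
    moment-0 = ≈-trans (+-identityˡ _) (+-identityʳ _)

-- Cumulants

interleaving-length-< : ∀ {a} {A : Set a} {as bs ys : List A} {b} → Interleaving as (b ∷ bs) ys →
                        length as < length ys
interleaving-length-< (consˡ i) = s≤s (interleaving-length-< i)
interleaving-length-< (consʳ i) = s≤s (proj₁ (interleaving-length i))

⟦1⋯⟧-unique : ∀ n → Unique ⟦1⋯ n ⟧
⟦1⋯⟧-unique n = Uniqueₚ.applyUpTo⁺₁ suc n λ i<j _ eq → <⇒≢ i<j (ℕₚ.suc-injective eq)

⟦_⋯1⟧ : ℕ → List ℕ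
⟦ n ⋯1⟧ = applyDownFrom suc n

∈-⟦⋯⟧ : ∀ {n x} → x ∈ ⟦1⋯ n ⟧ → x ∈ ⟦ n ⋯1⟧
∈-⟦⋯⟧ {n} x∈ with i , i<n , refl ← ∈-applyUpTo⁻ suc x∈ = ∈-applyDownFrom⁺ suc i<n

∈-⟦⋯⟧⁻ : ∀ {n x} → x ∈ ⟦ n ⋯1⟧ → x ∈ ⟦1⋯ n ⟧
∈-⟦⋯⟧⁻ {n} x∈ with i , i<n , refl ← ∈-applyDownFrom⁻ suc x∈ = ∈-applyUpTo⁺ suc i<n

isQcan-reorder : ∀ {X Y t} → (∀ {x} → x ∈ X → x ∈ Y) → (∀ {x} → x ∈ Y → x ∈ X) → IsQcan X t → IsQcan Y t
isQcan-reorder X⊆Y Y⊆X ((u , t⊆ , ⊆t) , d , q) =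
  (u , All.map X⊆Y t⊆ , All.tabulate (All.lookup ⊆t ∘ Y⊆X)) , d , q

module CumulantTrees {c ℓ₁ ℓ₂} (K : HeytingField c ℓ₁ ℓ₂) (κ : ℕ → HeytingField.Carrier K)
                     (X : List ℕ) (X! : Unique X) where
  open Summation K
  open TreeSums K
  open Trees X X!
  open GapWeights K κ X X!
  open Weights a
  open Counting K
  open Free κ

  convolve-cong : ∀ {b b′ h h′} → (∀ k → b k ≈ b′ k) → (∀ k → h k ≈ h′ k) → ∀ k →
      convolve b h k ≈ convolve b′ h′ k
  convolve-cong eqb eqh zero    = *-cong (eqb 0) (eqh 0)
  convolve-cong eqb eqh (suc k) = +-cong (*-cong (eqb 0) (eqh (suc k))) (convolve-cong (eqb ∘ suc) eqh k)

  convolve-negˡ : ∀ b h k → convolve (λ j → - b j) h k ≈ - convolve b h k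
  convolve-negˡ b h zero    = ≈-sym (-‿distribˡ-* _ _)
  convolve-negˡ b h (suc k) =
    ≈-trans (+-cong (≈-sym (-‿distribˡ-* _ _)) (convolve-negˡ (b ∘ suc) h k)) (-‿+-comm _ _)

  convolve-negʳ : ∀ b h k → convolve b (λ j → - h j) k ≈ - convolve b h k
  convolve-negʳ b h zero    = ≈-sym (-‿distribʳ-* _ _)
  convolve-negʳ b h (suc k) =
    ≈-trans (+-cong (≈-sym (-‿distribʳ-* _ _)) (convolve-negʳ (b ∘ suc) h k)) (-‿+-comm _ _)

  convolve-δ : ∀ b k → convolve b δ k ≈ b k
  convolve-δ b zero    = *-identityʳ _
  convolve-δ b (suc k) = ≈-trans (+-cong (zeroʳ _) (convolve-δ (b ∘ suc) k)) (+-identityˡ _)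

  a≈-κ : ∀ k → a k ≈ - κ (suc k)
  a≈-κ k = reflexive (cong (λ j → - κ j) (+ℕ-comm k 1))

  steps-cong : ∀ n {h h′} → (∀ k → h k ≈ h′ k) → ∀ k → steps n h k ≈ steps n h′ k
  steps-cong zero    eq = eq
  steps-cong (suc n) eq = steps-cong n λ k → +-cong (eq (suc k)) (convolve-cong (λ _ → ≈-refl) eq k)

  steps-neg : ∀ n h k → steps n (λ j → - h j) k ≈ - steps n h k
  steps-neg zero    h k = ≈-refl
  steps-neg (suc n) h k = ≈-trans
    (steps-cong n (λ j → ≈-trans (+-congˡ (convolve-negʳ (κ ∘ suc) h j)) (-‿+-comm _ _)) k)
    (steps-neg n (step h) k)

  freeMoment : ℕ → Carrier
  freeMoment n = steps n δ 0

  -- One `step` turns `δ` into the sequence of free cumulants, which is the negative of `a`, and the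
  -- sign passes through the remaining steps.
  freeMoment-suc : ∀ n → freeMoment (suc n) ≈ - steps n a 0
  freeMoment-suc n = ≈-trans (steps-cong n step-δ 0) (steps-neg n a 0)
    where
    step-δ : ∀ k → step δ k ≈ - a k
    step-δ k = begin
      0# + convolve (κ ∘ suc) δ k  ≈⟨ +-identityˡ _ ⟩
      convolve (κ ∘ suc) δ k       ≈⟨ convolve-δ (κ ∘ suc) k ⟩
      κ (suc k)                    ≈⟨ -‿involutive _ ⟨
      - - κ (suc k)                ≈⟨ -‿cong (a≈-κ k) ⟨
      - a k                        ∎

  Φ-suc : ∀ h Y → Φ (h ∘ suc) Y ≈ Φ (step h) Y + Φ (convolve a h) Y
  Φ-suc h Y = begin
    Φ (h ∘ suc) Y
      ≈⟨ ∑-cong (trees Y) (wt-cong h-suc) ⟩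
    Φ (λ k → 1# * step h k + convolve a h k) Y
      ≈⟨ Φ-linear 1# (step h) (convolve a h) Y ⟩
    1# * Φ (step h) Y + Φ (convolve a h) Y
      ≈⟨ +-congʳ (*-identityˡ _) ⟩
    Φ (step h) Y + Φ (convolve a h) Y ∎
    where
    h-suc : ∀ k → h (suc k) ≈ 1# * step h k + convolve a h k
    h-suc k = begin
      h (suc k)
        ≈⟨ +-identityʳ _ ⟨
      h (suc k) + 0#
        ≈⟨ +-congˡ (-‿inverseʳ _) ⟨
      h (suc k) + (convolve (κ ∘ suc) h k + - convolve (κ ∘ suc) h k)
        ≈⟨ +-assoc _ _ _ ⟨
      step h k + - convolve (κ ∘ suc) h k
        ≈⟨ +-cong (≈-sym (*-identityˡ _)) (≈-trans (≈-sym (convolve-negˡ (κ ∘ suc) h k))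
             (convolve-cong (≈-sym ∘ a≈-κ) (λ _ → ≈-refl) k)) ⟩
      1# * step h k + convolve a h k ∎

  -- The defect `Φ (convolve a h) Y` occurs both in `Φ-∷` and in `Φ-suc`, because `a` is the negated
  -- cumulant sequence of `step`; cancelling it leaves (Φ h)′ = Φ (S h) + Φ h · Φ a.
  Φ-∷-step : ∀ h {y Y} → Valid (y ∷ Y) →
    Φ h (y ∷ Y) ≈ Φ (step h) Y + ∑ (splits Y) (λ (A , B) → Φ h A * Φ a B)
  Φ-∷-step h {y} {Y} v = +-cancelʳ (Φ (convolve a h) Y) _ _ (begin
    Φ h (y ∷ Y) + Φ (convolve a h) Y                ≈⟨ Φ-∷ h v ⟩
    Φ (h ∘ suc) Y + S                               ≈⟨ +-congʳ (Φ-suc h Y) ⟩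
    Φ (step h) Y + Φ (convolve a h) Y + S           ≈⟨ +-assoc _ _ _ ⟩
    Φ (step h) Y + (Φ (convolve a h) Y + S)         ≈⟨ +-congˡ (+-comm _ _) ⟩
    Φ (step h) Y + (S + Φ (convolve a h) Y)         ≈⟨ +-assoc _ _ _ ⟨
    Φ (step h) Y + S + Φ (convolve a h) Y           ∎)
    where S = ∑ (splits Y) (λ (A , B) → Φ h A * Φ a B)

  -- With W the exponential generating function of Φ a and M that of the moments, the recursion
  -- for Φ h and M′ = - W M cancel the quadratic term.
  ∑-Φ-moments : ∀ n {Y} → length Y ≤ n → Valid Y → ∀ h →
    ∑ (splits Y) (λ (A , B) → Φ h A * freeMoment (length B)) ≈ steps (length Y) h 0
  ∑-Φ-moments n {[]} _ _ h =
    ≈-trans (+-identityʳ _) (≈-trans (*-identityʳ _) (∑-trees-[] 0 (wt h)))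
  ∑-Φ-moments (suc n) {y ∷ Y} (s≤s p) v h = begin
    ∑ (splits (y ∷ Y)) (λ (A , B) → Φ h A * freeMoment (length B))
      ≈⟨ ∑-splits-∷ y Y _ ⟩
    ∑ (splits Y) (λ (A , B) → Φ h (y ∷ A) * freeMoment (length B)) +
    ∑ (splits Y) (λ (A , B) → Φ h A * freeMoment (suc (length B)))
      ≈⟨ +-cong (∑-cong-∈ (splits Y) (grow ∘ splits⇒interleaving Y))
                (∑-cong-∈ (splits Y) (shrink ∘ splits⇒interleaving Y)) ⟩
    ∑ (splits Y) (λ (A , B) → Φ (step h) A * freeMoment (length B) +
      ∑ (splits A) λ (C , E) → G C E B) +
    ∑ (splits Y) (λ (A , B) → - ∑ (splits B) λ (C , E) → G A C E)
      ≈⟨ +-cong (∑-+ (splits Y) _ _) (∑-neg (splits Y) _) ⟩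
    (∑ (splits Y) (λ (A , B) → Φ (step h) A * freeMoment (length B)) +
     ∑ (splits Y) (λ (A , B) → ∑ (splits A) λ (C , E) → G C E B)) -
    ∑ (splits Y) (λ (A , B) → ∑ (splits B) λ (C , E) → G A C E)
      ≈⟨ +-assoc _ _ _ ⟩
    ∑ (splits Y) (λ (A , B) → Φ (step h) A * freeMoment (length B)) +
    (∑ (splits Y) (λ (A , B) → ∑ (splits A) λ (C , E) → G C E B) -
     ∑ (splits Y) (λ (A , B) → ∑ (splits B) λ (C , E) → G A C E))
      ≈⟨ +-congˡ (≈-trans (+-congˡ (-‿cong (∑-splits-assoc Y G))) (-‿inverseʳ _)) ⟩
    ∑ (splits Y) (λ (A , B) → Φ (step h) A * freeMoment (length B)) + 0#
      ≈⟨ +-identityʳ _ ⟩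
    ∑ (splits Y) (λ (A , B) → Φ (step h) A * freeMoment (length B))
      ≈⟨ ∑-Φ-moments n p (valid-tail v) (step h) ⟩
    steps (length Y) (step h) 0 ∎
    where
    G : List ℕ → List ℕ → List ℕ → Carrier
    G A C E = Φ h A * (Φ a C * freeMoment (length E))

    grow : ∀ {A B} → Interleaving A B Y → Φ h (y ∷ A) * freeMoment (length B) ≈
      Φ (step h) A * freeMoment (length B) + ∑ (splits A) λ (C , E) → G C E B
    grow {A} {B} i = begin
      Φ h (y ∷ A) * freeMoment (length B)
        ≈⟨ *-congʳ (Φ-∷-step h (proj₁ (valid-interleaving (consˡ i) v))) ⟩
      (Φ (step h) A + ∑ (splits A) λ (C , E) → Φ h C * Φ a E) * freeMoment (length B)
        ≈⟨ distribʳ _ _ _ ⟩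
      Φ (step h) A * freeMoment (length B) + (∑ (splits A) λ (C , E) → Φ h C * Φ a E) * freeMoment (length B)
        ≈⟨ +-congˡ (≈-trans (≈-sym (∑-*ʳ (splits A) (freeMoment (length B)) _))
            (∑-cong (splits A) λ _ → *-assoc _ _ _)) ⟩
      Φ (step h) A * freeMoment (length B) + (∑ (splits A) λ (C , E) → G C E B) ∎

    shrink : ∀ {A B} → Interleaving A B Y → Φ h A * freeMoment (suc (length B)) ≈
      - ∑ (splits B) λ (C , E) → G A C E
    shrink {A} {B} i = begin
      Φ h A * freeMoment (suc (length B))
        ≈⟨ *-congˡ (freeMoment-suc (length B)) ⟩
      Φ h A * - steps (length B) a 0
        -- The induction hypothesis is used at `a` and on the shorter list `B`, whatever the current
        -- `h` is.
        ≈⟨ *-congˡ (-‿cong (∑-Φ-moments n (≤-trans (proj₂ (interleaving-length i)) p)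
             (proj₂ (valid-interleaving i (valid-tail v))) a)) ⟨
      Φ h A * - ∑ (splits B) (λ (C , E) → Φ a C * freeMoment (length E))
        ≈⟨ -‿distribʳ-* _ _ ⟨
      - (Φ h A * ∑ (splits B) (λ (C , E) → Φ a C * freeMoment (length E)))
        ≈⟨ -‿cong (∑-*ˡ (splits B) (Φ h A) _) ⟨
      - ∑ (splits B) (λ (C , E) → G A C E) ∎

  module _ (c : ℕ → Carrier) (cc : CorrespondingClassical κ c) where
    open Classical c

    moment≈freeMoment : ∀ n → moment n ≈ freeMoment n
    moment≈freeMoment zero    = moment-0
    moment≈freeMoment (suc n) = begin
      moment (suc n)                  ≈⟨ momentFromClassical≈moment (suc n) ⟨
      momentFromClassical c (suc n)   ≈⟨ cc (suc n) (s≤s z≤n) ⟨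
      momentFromFree κ (suc n)        ≈⟨ momentFromFree≈steps (suc n) ⟩
      freeMoment (suc n)              ∎

    -- `Φ a` and the negated cumulants have the same product with the moments, namely -M′. As the
    -- moments begin with 1, agreement on all shorter label lists leaves agreement on `Y`.
    Φ≈-c : ∀ n {Y} → length Y ≤ n → Valid Y → Φ a Y ≈ - c (suc (length Y))
    Φ≈-c n {Y} p v = begin
      Φ a Y                               ≈⟨ *-identityʳ _ ⟨
      Φ a Y * 1#                          ≈⟨ *-congˡ moment-0 ⟨
      Φ a Y * moment 0                    ≈⟨ ∑-splits-cancel Y sums (shorter n p) ⟩
      - c (suc (length Y)) * moment 0     ≈⟨ *-congˡ moment-0 ⟩
      - c (suc (length Y)) * 1#           ≈⟨ *-identityʳ _ ⟩
      - c (suc (length Y))                ∎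
      where
      F G : List ℕ × List ℕ → Carrier
      F (A , B) = Φ a A * moment (length B)
      G (A , B) = - c (suc (length A)) * moment (length B)

      sums : ∑ (splits Y) F ≈ ∑ (splits Y) G
      sums = begin
        ∑ (splits Y) F
          ≈⟨ ∑-cong (splits Y) (λ (A , B) → *-congˡ (moment≈freeMoment (length B))) ⟩
        ∑ (splits Y) (λ (A , B) → Φ a A * freeMoment (length B))
          ≈⟨ ∑-Φ-moments n p v a ⟩
        steps (length Y) a 0
          ≈⟨ -‿involutive _ ⟨
        - - steps (length Y) a 0
          ≈⟨ -‿cong (freeMoment-suc (length Y)) ⟨
        - freeMoment (suc (length Y))
          ≈⟨ -‿cong (moment≈freeMoment (suc (length Y))) ⟨
        - moment (suc (length Y))
          ≈⟨ -‿cong (moment-suc Y) ⟩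
        - ∑ (splits Y) (λ (A , B) → c (suc (length A)) * moment (length B))
          ≈⟨ ∑-neg (splits Y) _ ⟨
        ∑ (splits Y) (λ (A , B) → - (c (suc (length A)) * moment (length B)))
          ≈⟨ ∑-cong (splits Y) (λ _ → -‿distribˡ-* _ _) ⟩
        ∑ (splits Y) G ∎

      shorter : ∀ n → length Y ≤ n → ∀ {A b B} → Interleaving A (b ∷ B) Y → F (A , b ∷ B) ≈ G (A , b ∷ B)
      shorter zero    p i with () ← ≤-trans (interleaving-length-< i) p
      shorter (suc n) p i = *-congʳ
          (Φ≈-c n (ℕ.s≤s⁻¹ (≤-trans (interleaving-length-< i) p)) (proj₁ (valid-interleaving i v)))

corollary4p2 : ∀ {a ℓ₁ ℓ₂} (K : HeytingField a ℓ₁ ℓ₂) →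
    let open HeytingField K
        open Cumulants K in
    (κ c : ℕ → Carrier) → CorrespondingClassical κ c →
    ∀ (n : ℕ) → 0 < n →
    - c n ≈ ∑ (Qcan (n ∸ 1)) λ T → weight κ (𝐪 T)
corollary4p2 K κ c cc (suc n) _ = ≈-sym (begin
  ∑ (Qcan n) (λ T → weight κ (𝐪 T))
    ≈⟨ ∑-cong-∈ (Qcan n)
        (λ {T} T∈ → let _ , d , q = proj₂ (∈-filter⁻ (isQcan? X) {xs = treesUpTo n X} T∈) in weight-𝐪 T d q) ⟩
  ∑ (Qcan n) (wt a)
    ≈⟨ ∑-filter (isQcan? X) (treesUpTo n X) (wt a) ⟩
  ∑ (treesUpTo n X) (λ T → when (does (isQcan? X T)) (wt a T))
    -- `IsQcan` depends only on the set of labels. The ascending list is exchanged for the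
    -- descending one, on which the recursion works, while `X` remains the pool.
    ≈⟨ ∑-cong (treesUpTo n X)
        (λ T → when-⇔ (mk⇔ (isQcan-reorder {t = T} ∈-⟦⋯⟧ ∈-⟦⋯⟧⁻) (isQcan-reorder {t = T} ∈-⟦⋯⟧⁻ ∈-⟦⋯⟧))
            (isQcan? X T) (isQcan? Y T)) ⟩
  ∑ (treesUpTo n X) (λ T → when (does (isQcan? Y T)) (wt a T))
    ≈⟨ ∑-filter (isQcan? Y) (treesUpTo n X) (wt a) ⟨
  ∑ (trees≤ n Y) (wt a)
    ≡⟨ cong (λ k → ∑ (trees≤ k Y) (wt a)) (length-applyDownFrom suc n) ⟨
  Φ a Y
    ≈⟨ Φ≈-c c cc (length Y) ≤-refl valid ⟩
  - c (suc (length Y))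
    ≡⟨ cong (λ k → - c (suc k)) (length-applyDownFrom suc n) ⟩
  - c (suc n) ∎)
  where
  X = ⟦1⋯ n ⟧
  Y = ⟦ n ⋯1⟧
  X! = ⟦1⋯⟧-unique n
  open Summation K
  open TreeSums K
  open Trees X X!
  open GapWeights K κ X X!
  open Weights a
  open CumulantTrees K κ X X!

  valid : Valid Y
  valid = AllPairsₚ.applyDownFrom⁺₁ suc n (λ j<i _ → s≤s j<i) , All.tabulate ∈-⟦⋯⟧⁻
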